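{- A finite simple graph $G$ is $\{P_5,\overline{P_5},C_5\}$-free if and only if at least one of the following holds: (a) $G$ is a split graph; (b) $G$ is obtained by substitution from smaller $\{P_5,\overline{P_5},C_5\}$-free graphs; (c) $G$ or $\overline{G}$ is obtained by split unification from smaller $\{P_5,\overline{P_5},C_5\}$-free graphs.
   Context: $P_5$ is the path on 5 vertices, $C_5$ the 5-cycle, $\overline{G}$ the complement of $G$. A graph is $\{P_5,\overline{P_5},C_5\}$-free if it has no induced subgraph isomorphic to any of $P_5$, $\overline{P_5}$, $C_5$. A graph is split if its vertex set can be partitioned into a clique and a stable set. Substitution: given vertex-disjoint graphs $G_0$ and $H$ and a vertex $x$ of $G_0$, the graph obtained by substituting $H$ for $x$ has vertex set $V(G_0\setminus x)\cup V(H)$, consists of the union of $G_0\setminus x$ and $H$, plus all edges between $V(H)$ and the neighbors of $x$ in $G_0$. "$G$ is obtained by substitution from smaller graphs in a class" means $G$ is isomorphic to such a graph where $G_0$ and $H$ both have fewer vertices than $G$ and both lie in the class. For $S\subseteq V(G)$ and $v\notin S$: $v$ is complete to $S$ if adjacent to all of $S$, anticomplete if adjacent to none, mixed on $S$ otherwise; a set is complete (anticomplete) to a disjoint set if each of its vertices is. An anticomponent of $S$ is a subset of $S$ inducing a connected component of the complement of $G[S]$. Composable pair: let $A,B,C,L,T$ be pairwise disjoint sets with $A,C$ non-empty, and $a^*,c^*$ two distinct vertices not in $A\cup B\cup C\cup L\cup T$. $G_1$ is a graph on $A\cup B\cup L\cup T\cup\{c^*\}$ such that $L$ is a (possibly empty)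 clique, $T$ is a (possibly empty) stable set, $A$ is complete to $B$ and anticomplete to $T$, some vertex of $A$ is complete to $L$, and $c^*$ is complete to $B\cup L$ and anticomplete to $A\cup T$ (other adjacencies arbitrary). $G_2$ is a graph on $B\cup C\cup L\cup T\cup\{a^*\}$ such that $G_2[B\cup L\cup T]=G_1[B\cup L\cup T]$, $T$ is anticomplete to $C$, $L$ is complete to $B\cup C$, $a^*$ is complete to $B\cup L$ and anticomplete to $C\cup T$, some vertex of $C$ is complete to $B$, and no vertex of $C$ is mixed on any anticomponent of $B$ (other adjacencies arbitrary). Its split unification is the graph on $A\cup B\cup C\cup L\cup T$ whose restriction to $A\cup B\cup L\cup T$ is $G_1\setminus c^*$, whose restriction to $B\cup C\cup L\cup T$ is $G_2\setminus a^*$, and in which $A$ is anticomplete to $C$. "$G$ is obtained by split unification from smaller graphs in a class" means $G$ is (isomorphic to) the split unification of a composable pair $(G_1,G_2)$ with $G_1,G_2$ in the class and each having fewer vertices than $G$. -}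

module Defs where

open import Data.Nat using (ℕ; zero; suc; _<_; _≡ᵇ_)
open import Data.Fin using (Fin; toℕ) renaming (_≟_ to _≟ᶠ_)
open import Data.Bool using (Bool; true; false; not; _∨_; _∧_; if_then_else_)
open import Data.Bool.Properties using (∨-comm)
open import Data.Maybe using (Maybe; just; nothing; fromMaybe)
open import Data.Product using (Σ; Σ-syntax; _×_; _,_)
open import Data.Sum using (_⊎_; inj₁; inj₂)
open import Data.Empty using (⊥)
open import Relation.Nullary using (¬_; Dec; yes; no; does; contradiction)
open import Relation.Nullary.Decidable using (map′)
open import Relation.Binary.PropositionalEquality
  using (_≡_; _≢_; refl; sym; trans; cong)
open import Relation.Binary.Definitions using (DecidableEquality)
open import Function.Bundles using (_↔_; Inverse)
open import Function.Definitions using (Injective)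
open import Function.Construct.Identity using (↔-id)

record Graph : Set₁ where
  field
    V      : Set
    size   : ℕ
    enum   : V ↔ Fin size
    adj    : V → V → Bool
    adj-sym    : ∀ x y → adj x y ≡ adj y x
    adj-irrefl : ∀ x → adj x x ≡ false

open Graph public

_≟V_ : (G : Graph) → DecidableEquality (V G)
_≟V_ G x y = map′ inj (cong to) (to x ≟ᶠ to y)
  where
  open Inverse (enum G)
  inj : to x ≡ to y → x ≡ y
  inj e = trans (sym (inverseʳ refl)) (trans (cong from e) (inverseʳ refl))

complAdj : (G : Graph) → V G → V G → Bool
complAdj G x y with _≟V_ G x y
... | yes _ = false
... | no  _ = not (adj G x y)

complAdj-sym : (G : Graph) → ∀ x y → complAdj G x y ≡ complAdj G y x
complAdj-sym G x y with _≟V_ G x y | _≟V_ G y x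
... | yes _ | yes _ = refl
... | yes p | no q  = contradiction (sym p) q
... | no q  | yes p = contradiction (sym p) q
... | no _  | no _  = cong not (adj-sym G x y)

complAdj-irrefl : (G : Graph) → ∀ x → complAdj G x x ≡ false
complAdj-irrefl G x with _≟V_ G x x
... | yes _ = refl
... | no q  = contradiction refl q

compl : Graph → Graph
compl G = record
  { V = V G ; size = size G ; enum = enum G ; adj = complAdj G
  ; adj-sym = complAdj-sym G ; adj-irrefl = complAdj-irrefl G }

InducedIn : Graph → Graph → Set
InducedIn H G =
  Σ[ f ∈ (V H → V G) ] Injective _≡_ _≡_ f ×
    (∀ x y → adj G (f x) (f y) ≡ adj H x y)

IsoTo : (G : Graph) (W : Set) → (W → W → Bool) → Set
IsoTo G W r =
  Σ[ e ∈ (V G ↔ W) ] (∀ x y → r (Inverse.to e x) (Inverse.to e y) ≡ adj G x y)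

p5adj : Fin 5 → Fin 5 → Bool
p5adj i j = (toℕ i ≡ᵇ suc (toℕ j)) ∨ (toℕ j ≡ᵇ suc (toℕ i))

c5adj : Fin 5 → Fin 5 → Bool
c5adj i j = p5adj i j ∨
  (((toℕ i ≡ᵇ 0) ∧ (toℕ j ≡ᵇ 4)) ∨ ((toℕ j ≡ᵇ 0) ∧ (toℕ i ≡ᵇ 4)))

private
  F5 = Fin 5
  p5-sym : ∀ (i j : F5) → p5adj i j ≡ p5adj j i
  p5-sym i j = ∨-comm (toℕ i ≡ᵇ suc (toℕ j)) _
  c5-sym : ∀ (i j : F5) → c5adj i j ≡ c5adj j i
  c5-sym i j rewrite p5-sym i j =
    cong (p5adj j i ∨_) (∨-comm ((toℕ i ≡ᵇ 0) ∧ (toℕ j ≡ᵇ 4)) _)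
  n≢ᵇsn : ∀ n → (n ≡ᵇ suc n) ≡ false
  n≢ᵇsn zero = refl
  n≢ᵇsn (suc n) = n≢ᵇsn n
  p5-irr : ∀ (i : F5) → p5adj i i ≡ false
  p5-irr i rewrite n≢ᵇsn (toℕ i) = refl
  c5-irr : ∀ (i : F5) → c5adj i i ≡ false
  c5-irr Fin.zero = refl
  c5-irr (Fin.suc Fin.zero) = refl
  c5-irr (Fin.suc (Fin.suc Fin.zero)) = refl
  c5-irr (Fin.suc (Fin.suc (Fin.suc Fin.zero))) = refl
  c5-irr (Fin.suc (Fin.suc (Fin.suc (Fin.suc Fin.zero)))) = refl

P5 : Graph
P5 = record { V = Fin 5 ; size = 5 ; enum = ↔-id (Fin 5) ; adj = p5adj
            ; adj-sym = p5-sym ; adj-irrefl = p5-irr }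

C5 : Graph
C5 = record { V = Fin 5 ; size = 5 ; enum = ↔-id (Fin 5) ; adj = c5adj
            ; adj-sym = c5-sym ; adj-irrefl = c5-irr }

Free : Graph → Set
Free G = ¬ InducedIn P5 G × ¬ InducedIn (compl P5) G × ¬ InducedIn C5 G

IsSplit : Graph → Set
IsSplit G = Σ[ K ∈ (V G → Bool) ]
  (∀ x y → x ≢ y → K x ≡ true → K y ≡ true → adj G x y ≡ true) ×
  (∀ x y → K x ≡ false → K y ≡ false → adj G x y ≡ false)

SubstV : (G0 : Graph) → V G0 → Graph → Set
SubstV G0 x H = (Σ[ v ∈ V G0 ] v ≢ x) ⊎ V H

substAdj : (G0 : Graph) (x : V G0) (H : Graph) →
           SubstV G0 x H → SubstV G0 x H → Bool
substAdj G0 x H (inj₁ (u , _)) (inj₁ (v , _)) = adj G0 u v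
substAdj G0 x H (inj₂ a)       (inj₂ b)       = adj H a b
substAdj G0 x H (inj₁ (u , _)) (inj₂ _)       = adj G0 u x
substAdj G0 x H (inj₂ _)       (inj₁ (v , _)) = adj G0 x v

ObtainedBySubstitution : Graph → Set₁
ObtainedBySubstitution G =
  Σ[ G0 ∈ Graph ] Σ[ x ∈ V G0 ] Σ[ H ∈ Graph ]
    size G0 < size G × size H < size G × Free G0 × Free H ×
    IsoTo G (SubstV G0 x H) (substAdj G0 x H)

data V₁ (A B L T : Set) : Set where
  a₁ : A → V₁ A B L T
  b₁ : B → V₁ A B L T
  l₁ : L → V₁ A B L T
  t₁ : T → V₁ A B L T
  c* : V₁ A B L T

data V₂ (B C L T : Set) : Set where
  b₂ : B → V₂ B C L T
  c₂ : C → V₂ B C L T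
  l₂ : L → V₂ B C L T
  t₂ : T → V₂ B C L T
  a* : V₂ B C L T

data Vᵤ (A B C L T : Set) : Set where
  aᵤ : A → Vᵤ A B C L T
  bᵤ : B → Vᵤ A B C L T
  cᵤ : C → Vᵤ A B C L T
  lᵤ : L → Vᵤ A B C L T
  tᵤ : T → Vᵤ A B C L T

data V₀ (B L T : Set) : Set where
  b₀ : B → V₀ B L T
  l₀ : L → V₀ B L T
  t₀ : T → V₀ B L T

module _ {A B C L T : Set} where
  emb₁ : V₀ B L T → V₁ A B L T
  emb₁ (b₀ b) = b₁ b
  emb₁ (l₀ l) = l₁ l
  emb₁ (t₀ t) = t₁ t

  emb₂ : V₀ B L T → V₂ B C L T
  emb₂ (b₀ b) = b₂ b
  emb₂ (l₀ l) = l₂ l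
  emb₂ (t₀ t) = t₂ t

  toV₁ : Vᵤ A B C L T → Maybe (V₁ A B L T)
  toV₁ (aᵤ a) = just (a₁ a)
  toV₁ (bᵤ b) = just (b₁ b)
  toV₁ (cᵤ c) = nothing
  toV₁ (lᵤ l) = just (l₁ l)
  toV₁ (tᵤ t) = just (t₁ t)

  toV₂ : Vᵤ A B C L T → Maybe (V₂ B C L T)
  toV₂ (aᵤ a) = nothing
  toV₂ (bᵤ b) = just (b₂ b)
  toV₂ (cᵤ c) = just (c₂ c)
  toV₂ (lᵤ l) = just (l₂ l)
  toV₂ (tᵤ t) = just (t₂ t)

  both : {X : Set} → (X → X → Bool) → Maybe X → Maybe X → Maybe Bool
  both r (just x) (just y) = just (r x y)
  both r _        _        = nothing

  -- adjacency of the split unification: G1 \ c* on A ∪ B ∪ L ∪ T,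
  -- G2 \ a* on B ∪ C ∪ L ∪ T (these agree on B ∪ L ∪ T for a composable
  -- pair), and A anticomplete to C.
  unifAdj : (V₁ A B L T → V₁ A B L T → Bool) →
            (V₂ B C L T → V₂ B C L T → Bool) →
            Vᵤ A B C L T → Vᵤ A B C L T → Bool
  unifAdj r₁ r₂ u v =
    fromMaybe (fromMaybe false (both r₂ (toV₂ u) (toV₂ v)))
              (both r₁ (toV₁ u) (toV₁ v))

data SameAnticomp {B : Set} (r : B → B → Bool) : B → B → Set where
  here : ∀ b → SameAnticomp r b b
  step : ∀ {b b' b''} → b ≢ b' → r b b' ≡ false →
         SameAnticomp r b' b'' → SameAnticomp r b b''

record Composable (A B C L T : Set) (G₁ G₂ : Graph)
                  (e₁ : V G₁ ↔ V₁ A B L T) (e₂ : V G₂ ↔ V₂ B C L T) : Set where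
  r₁ : V₁ A B L T → V₁ A B L T → Bool
  r₁ u v = adj G₁ (Inverse.from e₁ u) (Inverse.from e₁ v)
  r₂ : V₂ B C L T → V₂ B C L T → Bool
  r₂ u v = adj G₂ (Inverse.from e₂ u) (Inverse.from e₂ v)
  field
    A-nonempty : A
    C-nonempty : C
    L-clique₁    : ∀ l l' → l ≢ l' → r₁ (l₁ l) (l₁ l') ≡ true
    T-stable₁    : ∀ t t' → r₁ (t₁ t) (t₁ t') ≡ false
    A-B-complete : ∀ a b → r₁ (a₁ a) (b₁ b) ≡ true
    A-T-anticomplete : ∀ a t → r₁ (a₁ a) (t₁ t) ≡ false
    A-vertex-complete-L : Σ[ a ∈ A ] (∀ l → r₁ (a₁ a) (l₁ l) ≡ true)
    c*-B-complete : ∀ b → r₁ c* (b₁ b) ≡ true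
    c*-L-complete : ∀ l → r₁ c* (l₁ l) ≡ true
    c*-A-anticomplete : ∀ a → r₁ c* (a₁ a) ≡ false
    c*-T-anticomplete : ∀ t → r₁ c* (t₁ t) ≡ false
    same-on-BLT : ∀ u v → r₂ (emb₂ {A} {B} {C} u) (emb₂ {A} v)
                        ≡ r₁ (emb₁ {A} {B} {C} u) (emb₁ {A} {B} {C} v)
    T-C-anticomplete : ∀ t c → r₂ (t₂ t) (c₂ c) ≡ false
    L-B-complete : ∀ l b → r₂ (l₂ l) (b₂ b) ≡ true
    L-C-complete : ∀ l c → r₂ (l₂ l) (c₂ c) ≡ true
    a*-B-complete : ∀ b → r₂ a* (b₂ b) ≡ true
    a*-L-complete : ∀ l → r₂ a* (l₂ l) ≡ true
    a*-C-anticomplete : ∀ c → r₂ a* (c₂ c) ≡ false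
    a*-T-anticomplete : ∀ t → r₂ a* (t₂ t) ≡ false
    C-vertex-complete-B : Σ[ c ∈ C ] (∀ b → r₂ (c₂ c) (b₂ b) ≡ true)
    C-not-mixed : ∀ c b b' → SameAnticomp (λ x y → r₂ (b₂ x) (b₂ y)) b b' →
                  r₂ (c₂ c) (b₂ b) ≡ r₂ (c₂ c) (b₂ b')

ObtainedBySplitUnification : Graph → Set₁
ObtainedBySplitUnification G =
  Σ[ A ∈ Set ] Σ[ B ∈ Set ] Σ[ C ∈ Set ] Σ[ L ∈ Set ] Σ[ T ∈ Set ]
  Σ[ G₁ ∈ Graph ] Σ[ G₂ ∈ Graph ]
  Σ[ e₁ ∈ (V G₁ ↔ V₁ A B L T) ] Σ[ e₂ ∈ (V G₂ ↔ V₂ B C L T) ]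
    Composable A B C L T G₁ G₂ e₁ e₂ ×
    Free G₁ × Free G₂ × size G₁ < size G × size G₂ < size G ×
    IsoTo G (Vᵤ A B C L T)
      (unifAdj (λ u v → adj G₁ (Inverse.from e₁ u) (Inverse.from e₁ v))
               (λ u v → adj G₂ (Inverse.from e₂ u) (Inverse.from e₂ v)))

{-# OPTIONS --safe #-}

-- Forward direction.  By Földes and Hammer a graph without 2K₂, C₄ and C₅ is
-- split, so up to complementation there is a 2K₂.  Choose a maximal connected A
-- among the sets of at least two vertices whose anticomplete set R still contains
-- an edge: then every outside neighbour of A meets every edge of R.  Let B be the
-- vertices complete to A, L those mixed on A, and C and T the non-isolated and
-- isolated vertices of R.  Excluding P₅, its complement and C₅ yields all the
-- conditions of a split unification except that L be a clique.  If L is not a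
-- clique, consider the neighbours of A complete to C and their anticomponents with
-- at least two vertices; vertices of A are never mixed on them.  Choose such an
-- anticomponent Q for which the set of vertices of A ∪ T complete to Q is maximal.
-- Then only vertices of T are mixed on Q, and in the complement the same partition
-- formed with Q in place of A satisfies all the conditions.
--
-- Backward direction.  An obstruction has no proper homogeneous set, hence survives
-- substitution only inside a factor; in a split unification each colouring of it
-- by A, B, C, L, T either breaks an adjacency condition or can be carried into G₁
-- by contracting C to c*, or into G₂ by contracting A to a*.

module Submission where

open import Defs
open import Data.Bool using (Bool; true; false; not)
import Data.Bool.Properties as Bool
open import Data.Empty using (⊥; ⊥-elim)
open import Data.Fin using (Fin; zero; suc)
open import Data.Fin.Patterns using (0F; 1F; 2F; 3F; 4F)
import Data.Fin.Properties as Fin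
open import Data.List using (List; []; _∷_; filter; map; allFin; lookup; length)
open import Data.List.Extrema.Nat using (argmin; argmin-all; f[argmin]≤f[xs])
import Data.List.Membership.DecPropositional as DecMembership
open import Data.List.Membership.Propositional using (_∈_; lose)
open import Data.List.Membership.Propositional.Properties using (∈-filter⁺; ∈-filter⁻; ∈-lookup; ∈-map⁺; ∈-allFin)
open import Data.List.Membership.Propositional.Properties.WithK using (unique⇒irrelevant)
open import Data.List.Properties using (filter-notAll; length-tabulate)
open import Data.List.Relation.Unary.All as All using (All; []; _∷_)
open import Data.List.Relation.Unary.All.Properties using (all-filter)
open import Data.List.Relation.Unary.Any as Any using (here; there)
open import Data.List.Relation.Unary.Any.Properties using (lookup-index)
open import Data.List.Relation.Unary.Unique.Propositional using (Unique)
open import Data.List.Relation.Unary.Unique.Propositional.Properties using (allFin⁺; filter⁺)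
open import Data.Maybe using (Maybe; just; nothing)
import Data.Maybe.Properties as Maybe
open import Data.Nat using (ℕ; zero; suc; _≤_; _<_; z≤n; s≤s)
open import Data.Nat.Induction using (<-wellFounded)
open import Data.Nat.Properties using (m≤n⇒m≤1+n; <⇒≱)
open import Data.Product using (Σ-syntax; ∃; ∃₂; _×_; _,_; proj₁; proj₂)
open import Data.Sum using (_⊎_; inj₁; inj₂; [_,_]′) renaming (swap to swap-⊎)
open import Data.Vec as Vec using (Vec; []; _∷_; tabulate)
open import Data.Vec.Properties using (lookup∘tabulate)
open import Function using (case_of_; _∘_)
open import Function.Bundles using (_↔_; _⇔_; Inverse; mk↔ₛ′; mk⇔)
open import Function.Construct.Identity using (↔-id)
open import Induction.WellFounded using (Acc; acc)
open import Relation.Binary.Definitions using (DecidableEquality)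
open import Relation.Binary.PropositionalEquality using (_≡_; _≢_; refl; sym; trans; cong; cong₂; subst; subst₂)
open import Relation.Binary.PropositionalEquality.WithK using (≡-irrelevant)
open import Relation.Nullary using (¬_; Dec; yes; no; contradiction; does)
open import Relation.Nullary.Decidable using (_×-dec_; _⊎-dec_; _→-dec_; ¬?; from-yes; map′; dec-true; dec-false; decidable-stable)

-- Maximality of `A` is used only through single vertices: an outside neighbour of `A` missing both
-- ends of an edge of `R` could join `A`, and that edge would stay in `R`. The vertex of `A`
-- complete to `L`, and the one of `C` complete to `B`, come from an exchange: a vertex missing a
-- target is replaced by one that reaches it and keeps every target already reached. In the
-- complement, two conditions can fail for a badly chosen `Q`: the one between vertices mixed on `Q`
-- and non-isolated vertices complete to `Q`, and the unmixedness of the latter. Each failure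
-- exhibits another anticomponent to which every vertex of A ∪ T complete to `Q` is complete, and
-- one vertex more. This is why `Q` is chosen by maximality of that set. Backward, no obstruction
-- has two vertices with the same neighbours, so adjacency-preserving maps are automatically
-- injective, and the colourings of its five vertices are few enough (2^5 or 5^5) to be checked by
-- evaluation.

-- A finite graph given by adjacency and by non-adjacency of distinct vertices, so
-- that complementation merely exchanges the two relations.
record Structure : Set₁ where
  infix 4 _~_ _≁_
  field
    Vertex   : Set
    elems    : List Vertex
    complete : ∀ v → v ∈ elems
    _~_ _≁_  : Vertex → Vertex → Set
    ~-sym    : ∀ {x y} → x ~ y → y ~ x
    ≁-sym    : ∀ {x y} → x ≁ y → y ≁ x
    tri      : ∀ x y → x ≡ y ⊎ x ~ y ⊎ x ≁ y
    ~-irr    : ∀ {x} → ¬ x ~ x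
    ≁-irr    : ∀ {x} → ¬ x ≁ x
    ~∧≁      : ∀ {x y} → x ~ y → ¬ x ≁ y
    p5       : ∀ {a b c d e} → a ~ b → b ~ c → c ~ d → d ~ e →
               a ≁ c → a ≁ d → a ≁ e → b ≁ d → b ≁ e → c ≁ e → ⊥
    co-p5    : ∀ {a b c d e} → a ≁ b → b ≁ c → c ≁ d → d ≁ e →
               a ~ c → a ~ d → a ~ e → b ~ d → b ~ e → c ~ e → ⊥
    c5       : ∀ {a b c d e} → a ~ b → b ~ c → c ~ d → d ~ e → e ~ a →
               a ≁ c → a ≁ d → b ≁ d → b ≁ e → c ≁ e → ⊥

swap : Structure → Structure
swap S = record
  { Vertex = Vertex ; elems = elems ; complete = complete ; _~_ = _≁_ ; _≁_ = _~_
  ; ~-sym = ≁-sym ; ≁-sym = ~-sym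
  ; tri = λ x y → [ inj₁ , [ (λ p → inj₂ (inj₂ p)) , (λ p → inj₂ (inj₁ p)) ]′ ]′ (tri x y)
  ; ~-irr = ≁-irr ; ≁-irr = ~-irr ; ~∧≁ = λ p q → ~∧≁ q p
  ; p5 = co-p5 ; co-p5 = p5
  ; c5 = λ ab bc cd de ea ac ad bd be ce → 
      c5 ac ce (~-sym be) bd (~-sym ad) (≁-sym ea) ab (≁-sym bc) cd (≁-sym de) }
  where open Structure S

data Part : Set where
  pA pB pC pL pT : Part

-- A split unification seen inside a graph: a and c represent a* and c*, while a′
-- and c′ witness that contracting A or C leaves a smaller graph.
record Divide {V : Set} (_~_ _≁_ : V → V → Set) : Set where
  field
    part : V → Part
  In : Part → V → Set
  In p v = part v ≡ p
  field
    A-B : ∀ {x y} → In pA x → In pB y → x ~ y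
    A-T : ∀ {x y} → In pA x → In pT y → x ≁ y
    A-C : ∀ {x y} → In pA x → In pC y → x ≁ y
    C-T : ∀ {x y} → In pC x → In pT y → x ≁ y
    L-B : ∀ {x y} → In pL x → In pB y → x ~ y
    L-C : ∀ {x y} → In pL x → In pC y → x ~ y
    L-L : ∀ {x y} → In pL x → In pL y → x ≢ y → x ~ y
    T-T : ∀ {x y} → In pT x → In pT y → x ≢ y → x ≁ y
    a   : V
    a∈A : In pA a
    a-L : ∀ {l} → In pL l → a ~ l
    a′  : V
    a′∈A : In pA a′
    a′≢a : a′ ≢ a
    c   : V
    c∈C : In pC c
    c-B : ∀ {b} → In pB b → c ~ b
    c′  : V
    c′∈C : In pC c′
    c′≢c : c′ ≢ c
    C-unmixed : ∀ {x b b′} → In pC x → In pB b → In pB b′ → b ≁ b′ → x ~ b → x ~ b′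

-- Finite search, growth of vertex sets, connected components

module Basics (S : Structure) where
  open Structure S

  ~⇒≢ : ∀ {x y} → x ~ y → x ≢ y
  ~⇒≢ p refl = ~-irr p

  ≁⇒≢ : ∀ {x y} → x ≁ y → x ≢ y
  ≁⇒≢ p refl = ≁-irr p

  _≟_ : (x y : Vertex) → Dec (x ≡ y)
  x ≟ y with tri x y
  ... | inj₁ p = yes p
  ... | inj₂ (inj₁ p) = no (~⇒≢ p)
  ... | inj₂ (inj₂ p) = no (≁⇒≢ p)

  _~?_ : (x y : Vertex) → Dec (x ~ y)
  x ~? y with tri x y
  ... | inj₁ refl = no ~-irr
  ... | inj₂ (inj₁ p) = yes p
  ... | inj₂ (inj₂ q) = no λ p → ~∧≁ p q

  _≁?_ : (x y : Vertex) → Dec (x ≁ y)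
  x ≁? y with tri x y
  ... | inj₁ refl = no ≁-irr
  ... | inj₂ (inj₁ p) = no (~∧≁ p)
  ... | inj₂ (inj₂ q) = yes q

  adjacency : ∀ {x y} → x ≢ y → x ~ y ⊎ x ≁ y
  adjacency {x} {y} x≢y with tri x y
  ... | inj₁ p = contradiction p x≢y
  ... | inj₂ q = q

  -- The alternatives need not be complementary: a failed universal statement comes with positive
  -- evidence, such as `x ≁ a` instead of a negated adjacency.
  omniscience : ∀ {p q} {P : Vertex → Set p} {Q : Vertex → Set q} → (∀ x → P x ⊎ Q x) → (∀ x → P x) ⊎ ∃ Q
  omniscience {P = P} {Q} P⊎Q with go elems
    where
    go : ∀ xs → All P xs ⊎ ∃ Q
    go [] = inj₁ []
    go (x ∷ xs) with P⊎Q x | go xs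
    ... | inj₂ q | _ = inj₂ (x , q)
    ... | inj₁ _ | inj₂ q = inj₂ q
    ... | inj₁ p | inj₁ ps = inj₁ (p ∷ ps)
  ... | inj₁ ps = inj₁ (λ x → All.lookup ps (complete x))
  ... | inj₂ q = inj₂ q

  -- The complement of P₅ drawn as a house: the square `w x y z` with roof `u` over the side `w x`.
  -- The path in the complement is `w y u z x`.
  house : ∀ {w x y z u} → w ~ x → x ~ y → y ~ z → z ~ w → u ~ w → u ~ x →
          w ≁ y → x ≁ z → u ≁ y → u ≁ z → ⊥
  house wx xy yz zw uw ux wy xz uy uz =
    co-p5 wy (≁-sym uy) uz (≁-sym xz) (~-sym uw) (~-sym zw) wx yz (~-sym xy) ux

  -- Counting the vertices outside `A` turns growth of `A` into descent in ℕ; the same count later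
  -- ranks the anticomponents.
  misses : (Vertex → Bool) → List Vertex → ℕ
  misses A [] = 0
  misses A (x ∷ xs) with A x
  ... | true = misses A xs
  ... | false = suc (misses A xs)

  module _ {A A′ : Vertex → Bool} (A⊆A′ : ∀ {x} → A x ≡ true → A′ x ≡ true) where

    misses-≤ : ∀ xs → misses A′ xs ≤ misses A xs
    misses-≤ [] = z≤n
    misses-≤ (x ∷ xs) with A x in eq | A′ x in eq′
    ... | true | true = misses-≤ xs
    ... | true | false = case trans (sym (A⊆A′ eq)) eq′ of λ ()
    ... | false | true = m≤n⇒m≤1+n (misses-≤ xs)
    ... | false | false = s≤s (misses-≤ xs)

    misses-< : ∀ {n xs} → n ∈ xs → A n ≡ false → A′ n ≡ true → misses A′ xs < misses A xs
    misses-< {xs = x ∷ xs} (here refl) n∉A n∈A′ with A x | A′ x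
    ... | false | true = s≤s (misses-≤ xs)
    misses-< {xs = x ∷ xs} (there n∈xs) n∉A n∈A′ with A x in eq | A′ x in eq′
    ... | true | true = misses-< n∈xs n∉A n∈A′
    ... | true | false = case trans (sym (A⊆A′ eq)) eq′ of λ ()
    ... | false | true = m≤n⇒m≤1+n (misses-< n∈xs n∉A n∈A′)
    ... | false | false = s≤s (misses-< n∈xs n∉A n∈A′)

  insert : Vertex → (Vertex → Bool) → Vertex → Bool
  insert n A x with x ≟ n
  ... | yes _ = true
  ... | no _ = A x

  insert-self : ∀ n A → insert n A n ≡ true
  insert-self n A with n ≟ n
  ... | yes _ = refl
  ... | no n≢n = contradiction refl n≢n

  insert-⊇ : ∀ n {A} {x} → A x ≡ true → insert n A x ≡ true
  insert-⊇ n {x = x} x∈A with x ≟ n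
  ... | yes _ = refl
  ... | no _ = x∈A

  insert⁻ : ∀ {n A x} → insert n A x ≡ true → x ≡ n ⊎ A x ≡ true
  insert⁻ {n} {x = x} p with x ≟ n
  ... | yes q = inj₁ q
  ... | no _ = inj₂ p

  -- The set reached is maximal only against the one-vertex extensions offered by `advance`. Closure
  -- of a component and the choice of `A` ask for no more.
  grow : ∀ {ℓ ℓ′} {State : (Vertex → Bool) → Set ℓ} {Done : (Vertex → Bool) → Set ℓ′} →
         (∀ A → State A → Done A ⊎ ∃ λ n → A n ≡ false × State (insert n A)) →
         ∀ A → State A → ∃ λ A → State A × Done A
  grow {State = State} {Done} advance A = go A (<-wellFounded _)
    where
    go : ∀ A → Acc _<_ (misses A elems) → State A → ∃ λ A → State A × Done A
    go A (acc rs) s with advance A s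
    ... | inj₁ d = A , s , d
    ... | inj₂ (n , n∉A , s′) =
      go (insert n A) (rs (misses-< (insert-⊇ n {A}) (complete n) n∉A (insert-self n A))) s′

  -- Targets are treated one at a time. Since the replacement `c′` keeps all neighbours of `c` in
  -- `L`, the targets already treated are never lost.
  gather : {P L : Vertex → Set} → (∀ x → Dec (L x)) → ∃ P →
           (∀ {c l} → P c → L l →
              c ~ l ⊎ ∃ λ c′ → P c′ × c′ ~ l × (∀ {s} → L s → c ~ s → c′ ~ s)) →
           ∃ λ c → P c × (∀ {l} → L l → c ~ l)
  gather {P} {L} L? start improve with go elems
    where
    go : ∀ xs → ∃ λ c → P c × (∀ {l} → l ∈ xs → L l → c ~ l)
    go [] = proj₁ start , proj₂ start , λ ()
    go (x ∷ xs) with go xs | L? x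
    ... | c , Pc , c-xs | no ¬Lx =
      c , Pc , λ { (here refl) Ll → contradiction Ll ¬Lx ; (there i) Ll → c-xs i Ll }
    ... | c , Pc , c-xs | yes Lx with improve Pc Lx
    ... | inj₁ c~x = c , Pc , λ { (here refl) _ → c~x ; (there i) Ll → c-xs i Ll }
    ... | inj₂ (c′ , Pc′ , c′~x , keep) =
      c′ , Pc′ , λ { (here refl) _ → c′~x ; (there i) Ll → keep Ll (c-xs i Ll) }
  ... | c , Pc , c-L = c , Pc , λ {l} → c-L (complete l)

  -- Connectedness as the absence of a cut without crossing edge.
  Connected : (Vertex → Bool) → Set₁
  Connected A = ∀ {P Q : Vertex → Set} → (∀ {x} → A x ≡ true → P x ⊎ Q x) → (∀ {x} → P x → ¬ Q x) →
    ∀ {u v} → A u ≡ true → P u → A v ≡ true → Q v →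
    ∃₂ λ x y → A x ≡ true × A y ≡ true × P x × Q y × x ~ y

  -- If both sides of the cut meet `A`, a crossing edge exists inside `A`. Otherwise `A` lies on one
  -- side and `n` on the other, and the edge between `n` and `m` crosses.
  Connected-insert : ∀ {A n m} → Connected A → A m ≡ true → n ~ m → Connected (insert n A)
  Connected-insert {A} {n} {m} conn m∈A n~m {P} {Q} P⊎Q disj {u} {v} u∈ Pu v∈ Qv
    with omniscience {P = λ x → A x ≡ true → P x} {Q = λ x → A x ≡ true × Q x} onA
       | omniscience {P = λ x → A x ≡ true → Q x} {Q = λ x → A x ≡ true × P x} onA′
    where
    onA : ∀ x → (A x ≡ true → P x) ⊎ (A x ≡ true × Q x)
    onA x with A x in eq
    ... | false = inj₁ λ ()
    ... | true with P⊎Q (insert-⊇ n eq)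
    ... | inj₁ p = inj₁ λ _ → p
    ... | inj₂ q = inj₂ (refl , q)
    onA′ : ∀ x → (A x ≡ true → Q x) ⊎ (A x ≡ true × P x)
    onA′ x with A x in eq
    ... | false = inj₁ λ ()
    ... | true with P⊎Q (insert-⊇ n eq)
    ... | inj₁ p = inj₂ (refl , p)
    ... | inj₂ q = inj₁ λ _ → q
  ... | inj₂ (y , y∈A , Qy) | inj₂ (x , x∈A , Px)
        with conn (λ x∈ → P⊎Q (insert-⊇ n x∈)) disj x∈A Px y∈A Qy
  ... | x , y , x∈ , y∈ , rest = x , y , insert-⊇ n x∈ , insert-⊇ n y∈ , rest
  Connected-insert {A} {n} {m} conn m∈A n~m {P} {Q} P⊎Q disj {u} {v} u∈ Pu v∈ Qv
    | inj₁ allP | _ with insert⁻ {n} {A} v∈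
  ... | inj₁ refl = m , n , insert-⊇ n m∈A , v∈ , allP m m∈A , Qv , ~-sym n~m
  ... | inj₂ v∈A = contradiction Qv (disj (allP v v∈A))
  Connected-insert {A} {n} {m} conn m∈A n~m {P} {Q} P⊎Q disj {u} {v} u∈ Pu v∈ Qv
    | inj₂ _ | inj₁ allQ with insert⁻ {n} {A} u∈
  ... | inj₁ refl = n , m , u∈ , insert-⊇ n m∈A , Pu , allQ m m∈A , n~m
  ... | inj₂ u∈A = contradiction (allQ u u∈A) (disj Pu)

  singleton : Vertex → Vertex → Bool
  singleton p = insert p (λ _ → false)

  singleton⁻ : ∀ {p x} → singleton p x ≡ true → x ≡ p
  singleton⁻ q with insert⁻ {A = λ _ → false} q
  ... | inj₁ e = e

  Connected-singleton : ∀ p → Connected (singleton p)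
  Connected-singleton p _ disj u∈ Pu v∈ Qv with singleton⁻ u∈ | singleton⁻ v∈
  ... | refl | refl = contradiction Qv (disj Pu)

  record Component (M : Vertex → Set) (p : Vertex) : Set₁ where
    field
      mem       : Vertex → Bool
      root      : mem p ≡ true
      connected : Connected mem
      inside    : ∀ {x} → mem x ≡ true → M x
      closed    : ∀ {x y} → mem x ≡ true → M y → x ~ y → mem y ≡ true

  component : ∀ {M} → (∀ x → Dec (M x)) → ∀ {p} → M p → Component M p
  component {M} M? {p} Mp with grow advance (singleton p) (insert-self p _ , Connected-singleton p , λ q → subst M (sym (singleton⁻ q)) Mp)
    where
    State : (Vertex → Bool) → Set₁
    State A = A p ≡ true × Connected A × (∀ {x} → A x ≡ true → M x)
    Done : (Vertex → Bool) → Set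
    Done A = ∀ y x → A x ≡ true → M y → x ~ y → A y ≡ true
    advance : ∀ A → State A → Done A ⊎ ∃ λ n → A n ≡ false × State (insert n A)
    advance A (root , conn , inside) with omniscience test
      where
      test : ∀ y → (∀ x → A x ≡ true → M y → x ~ y → A y ≡ true) ⊎ (∃ λ x → A x ≡ true × M y × x ~ y × A y ≡ false)
      test y with A y in eq | M? y
      ... | true | _ = inj₁ λ _ _ _ _ → refl
      ... | false | no ¬My = inj₁ λ _ _ My → contradiction My ¬My
      ... | false | yes My = omniscience at
        where
        at : ∀ x → (A x ≡ true → M y → x ~ y → false ≡ true) ⊎ (A x ≡ true × M y × x ~ y × false ≡ false)
        at x with A x in eqx | tri x y
        ... | false | _ = inj₁ λ ()
        ... | true | inj₁ refl = inj₁ λ _ _ p → ⊥-elim (~-irr p)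
        ... | true | inj₂ (inj₁ p) = inj₂ (refl , My , p , refl)
        ... | true | inj₂ (inj₂ q) = inj₁ λ _ _ p → ⊥-elim (~∧≁ p q)
    ... | inj₁ done = inj₁ done
    ... | inj₂ (n , x , x∈A , Mn , x~n , n∉A) = inj₂ (n , n∉A , insert-⊇ n root
            , Connected-insert conn x∈A (~-sym x~n)
            , λ q → [ (λ e → subst M (sym e) Mn) , inside ]′ (insert⁻ {n} {A} q))
  ... | A , (root , conn , inside) , done = record
    { mem = A ; root = root ; connected = conn ; inside = inside ; closed = λ x∈ My xy → done _ _ x∈ My xy }

-- The partition determined by a connected set

module Sides (S : Structure) (A : Structure.Vertex S → Bool) where
  open Structure S
  open Basics S

  -- Irreflexivity of `_~_` and of `_≁_` keeps vertices of `A` out of `Complete` and `Anti`; only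
  -- `Mixed` has to exclude them explicitly. Passing to `swap S` exchanges `Complete` and `Anti`.
  Complete Anti Mixed Active Isolated : Vertex → Set
  Complete x = ∀ {a} → A a ≡ true → x ~ a
  Anti x = ∀ {a} → A a ≡ true → x ≁ a
  Mixed x = A x ≡ false × (∃ λ a → A a ≡ true × x ~ a) × (∃ λ a → A a ≡ true × x ≁ a)
  Active x = Anti x × ∃ λ y → Anti y × x ~ y
  Isolated x = Anti x × (∀ {y} → Anti y → ¬ x ~ y)

  Spec : Part → Vertex → Set
  Spec pA x = A x ≡ true
  Spec pB x = Complete x
  Spec pC x = Active x
  Spec pL x = Mixed x
  Spec pT x = Isolated x

  Anti? : ∀ y → Dec (Anti y)
  Anti? y with omniscience at
    where
    at : ∀ a → (A a ≡ true → y ≁ a) ⊎ (A a ≡ true × ¬ y ≁ a)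
    at a with A a in eq | tri y a
    ... | false | _ = inj₁ λ ()
    ... | true | inj₁ refl = inj₂ (refl , ≁-irr)
    ... | true | inj₂ (inj₁ p) = inj₂ (refl , ~∧≁ p)
    ... | true | inj₂ (inj₂ q) = inj₁ λ _ → q
  ... | inj₁ anti = yes λ {a} → anti a
  ... | inj₂ (a , a∈A , ¬q) = no λ anti → ¬q (anti a∈A)

  classify : ∀ x → Σ[ p ∈ Part ] Spec p x
  classify x with A x in x∈?
  ... | true = pA , x∈?
  ... | false with omniscience toA
    where
    toA : ∀ a → (A a ≡ true → x ~ a) ⊎ (A a ≡ true × x ≁ a)
    toA a with A a in eq | tri x a
    ... | false | _ = inj₁ λ ()
    ... | true | inj₁ refl = case trans (sym eq) x∈? of λ ()
    ... | true | inj₂ (inj₁ p) = inj₁ λ _ → p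
    ... | true | inj₂ (inj₂ q) = inj₂ (refl , q)
  ... | inj₁ compl = pB , λ {a} → compl a
  ... | inj₂ nonneighbour with omniscience toA
    where
    toA : ∀ a → (A a ≡ true → x ≁ a) ⊎ (A a ≡ true × x ~ a)
    toA a with A a in eq | tri x a
    ... | false | _ = inj₁ λ ()
    ... | true | inj₁ refl = case trans (sym eq) x∈? of λ ()
    ... | true | inj₂ (inj₁ p) = inj₂ (refl , p)
    ... | true | inj₂ (inj₂ q) = inj₁ λ _ → q
  ... | inj₂ neighbour = pL , x∈? , neighbour , nonneighbour
  ... | inj₁ anti with omniscience toR
    where
    toR : ∀ y → (Anti y → ¬ x ~ y) ⊎ (Anti y × x ~ y)
    toR y with tri x y | Anti? y
    ... | _ | no ¬anti = inj₁ λ anti → ⊥-elim (¬anti anti)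
    ... | inj₂ (inj₁ p) | yes anti = inj₂ (anti , p)
    ... | inj₁ refl | yes _ = inj₁ λ _ → ~-irr
    ... | inj₂ (inj₂ q) | yes _ = inj₁ λ _ p → ~∧≁ p q
  ... | inj₁ isolated = pT , (λ {a} → anti a) , λ {y} → isolated y
  ... | inj₂ neighbour = pC , (λ {a} → anti a) , neighbour

  part : Vertex → Part
  part x = proj₁ (classify x)

  spec : ∀ {p x} → part x ≡ p → Spec p x
  spec {x = x} refl = proj₂ (classify x)

  Anti⇒∉ : ∀ {x} → Anti x → A x ≡ false
  Anti⇒∉ {x} anti with A x in eq
  ... | false = refl
  ... | true = ⊥-elim (≁-irr (anti eq))

  in-A : ∀ {x} → A x ≡ true → part x ≡ pA
  in-A {x} x∈A with part x in eq
  ... | pA = refl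
  ... | pB = ⊥-elim (~-irr (spec {pB} eq x∈A))
  ... | pC = ⊥-elim (≁-irr (proj₁ (spec {pC} eq) x∈A))
  ... | pT = ⊥-elim (≁-irr (proj₁ (spec {pT} eq) x∈A))
  ... | pL = case trans (sym x∈A) (proj₁ (spec {pL} eq)) of λ ()

  Complete⇒∉ : ∀ {b} → Complete b → A b ≡ false
  Complete⇒∉ {b} compl with A b in eq
  ... | false = refl
  ... | true = ⊥-elim (~-irr (compl eq))

  Isolated-T : ∀ {x y} → Isolated x → Anti y → x ≢ y → x ≁ y
  Isolated-T {x} (_ , iso) anti x≢y with adjacency x≢y
  ... | inj₁ p = contradiction p (iso anti)
  ... | inj₂ q = q

  module _ {u₁} (u₁∈A : A u₁ ≡ true) where

    disjoint-Anti : ∀ {x} → Anti x → ¬ Complete x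
    disjoint-Anti anti compl = ~∧≁ (compl u₁∈A) (anti u₁∈A)

    -- A vertex of `A` is required here: for empty `A` every vertex is vacuously complete to `A`,
    -- and `classify` would choose `pB`.
    in-C : ∀ {x} → Active x → part x ≡ pC
    in-C {x} (anti , y , anti-y , x~y) with part x in eq
    ... | pC = refl
    ... | pA = case trans (sym (spec {pA} eq)) (Anti⇒∉ anti) of λ ()
    ... | pB = ⊥-elim (disjoint-Anti anti (spec {pB} eq))
    ... | pL with spec {pL} eq
    ...   | _ , (_ , a∈A , x~a) , _ = ⊥-elim (~∧≁ x~a (anti a∈A))
    in-C {x} (anti , y , anti-y , x~y) | pT with spec {pT} eq
    ...   | _ , iso = ⊥-elim (iso anti-y x~y)

  Mixed? : ∀ x → Dec (Mixed x)
  Mixed? x with classify x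
  ... | pL , m = yes m
  ... | pA , x∈A = no λ (x∉A , _) → case trans (sym x∈A) x∉A of λ ()
  ... | pB , compl = no λ (_ , _ , _ , a∈A , x≁a) → ~∧≁ (compl a∈A) x≁a
  ... | pC , (anti , _) = no λ (_ , (_ , a∈A , x~a) , _) → ~∧≁ x~a (anti a∈A)
  ... | pT , (anti , _) = no λ (_ , (_ , a∈A , x~a) , _) → ~∧≁ x~a (anti a∈A)

  -- The vertex of `A` complete to `L` is the one existence claim still to be proved. The hypotheses
  -- are stated for an arbitrary structure so that the complement, with `Q` as `A`, can be fed in as
  -- well.
  divide : Connected A → ∀ {u₁ u₂} → A u₁ ≡ true → A u₂ ≡ true → u₁ ≢ u₂ →
    (∀ {x y} → Mixed x → Mixed y → ¬ x ≁ y) →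
    (∀ {x y} → Mixed x → Complete y → x ~ y) →
    (∀ {x y} → Mixed x → Active y → x ~ y) →
    (∃ λ c → Active c × (∀ {b} → Complete b → c ~ b)) →
    (∀ {x b b′} → Active x → Complete b → Complete b′ → b ≁ b′ → x ~ b → x ~ b′) →
    Divide _~_ _≁_
  divide conn {u₁} {u₂} u₁∈A u₂∈A u₁≢u₂ clique L-B L-C (c , Cc@(anti-c , c′ , anti-c′ , c~c′) , c-B) unmixed
    with gather Mixed? (u₁ , u₁∈A) improve
    where
    Near : Vertex → Vertex → Vertex → Set
    Near l a x = A x ≡ true × x ~ l × a ~ x

    neighbour : ∀ l a x → ¬ Near l a x ⊎ Near l a x
    neighbour l a x with A x | tri x l | tri a x
    ... | false | _ | _ = inj₁ λ ()
    ... | true | inj₁ refl | _ = inj₁ λ (_ , p , _) → ~-irr p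
    ... | true | inj₂ (inj₂ q) | _ = inj₁ λ (_ , p , _) → ~∧≁ p q
    ... | true | inj₂ (inj₁ _) | inj₁ refl = inj₁ λ (_ , _ , p) → ~-irr p
    ... | true | inj₂ (inj₁ _) | inj₂ (inj₂ q) = inj₁ λ (_ , _ , p) → ~∧≁ p q
    ... | true | inj₂ (inj₁ x~l) | inj₂ (inj₁ a~x) = inj₂ (refl , x~l , a~x)

    -- Cut `A` between the vertices within distance two of `l` and the others. If `a` were among the
    -- others, a crossing edge `x ~ w` would give, with some `z` adjacent to both `l` and `x`, the
    -- induced path `c l z x w`.
    common : ∀ {a l} → A a ≡ true → Mixed l → a ≁ l → ∃ λ y → Near l a y
    common {a} {l} a∈A Ml@(_ , (y , y∈A , l~y) , _) a≁l
      with omniscience (neighbour l a)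
    ... | inj₂ found = found
    ... | inj₁ none with conn {P = λ x → x ~ l ⊎ ∃ (Near l x)} {Q = λ x → ¬ (x ~ l ⊎ ∃ (Near l x))}
                          (λ {x} _ → reach x) (λ p q → q p) y∈A (inj₁ (~-sym l~y)) a∈A
                          [ (λ p → ~∧≁ p a≁l) , (λ (x , near) → none x near) ]′
      where
      reach : ∀ x → (x ~ l ⊎ ∃ (Near l x)) ⊎ ¬ (x ~ l ⊎ ∃ (Near l x))
      reach x with tri x l | omniscience (neighbour l x)
      ... | inj₂ (inj₁ p) | _ = inj₁ (inj₁ p)
      ... | _ | inj₂ near = inj₁ (inj₂ near)
      ... | inj₁ refl | inj₁ none = inj₂ [ ~-irr , (λ (y , near) → none y near) ]′
      ... | inj₂ (inj₂ q) | inj₁ none = inj₂ [ (λ p → ~∧≁ p q) , (λ (y , near) → none y near) ]′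
    ... | x , w , x∈A , w∈A , inj₁ x~l , ¬w , x~w = ⊥-elim (¬w (inj₂ (x , x∈A , x~l , ~-sym x~w)))
    ... | x , w , x∈A , w∈A , inj₂ (z , z∈A , z~l , x~z) , ¬w , x~w with tri x l | tri w l | tri z w
    ... | inj₁ refl | _ | _ = case trans (sym x∈A) (proj₁ Ml) of λ ()
    ... | inj₂ (inj₁ x~l) | _ | _ = ⊥-elim (¬w (inj₂ (x , x∈A , x~l , ~-sym x~w)))
    ... | _ | inj₁ refl | _ = case trans (sym w∈A) (proj₁ Ml) of λ ()
    ... | _ | inj₂ (inj₁ w~l) | _ = ⊥-elim (¬w (inj₁ w~l))
    ... | _ | _ | inj₁ refl = ⊥-elim (¬w (inj₁ z~l))
    ... | _ | _ | inj₂ (inj₁ z~w) = ⊥-elim (¬w (inj₂ (z , z∈A , z~l , ~-sym z~w)))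
    ... | inj₂ (inj₂ x≁l) | inj₂ (inj₂ w≁l) | inj₂ (inj₂ z≁w) = ⊥-elim
      (p5 (~-sym (L-C Ml Cc)) (~-sym z~l) (~-sym x~z) x~w
          (anti-c z∈A) (anti-c x∈A) (anti-c w∈A) (≁-sym x≁l) (≁-sym w≁l) z≁w)

    improve : ∀ {a l} → A a ≡ true → Mixed l →
      a ~ l ⊎ ∃ λ a′ → A a′ ≡ true × a′ ~ l × (∀ {s} → Mixed s → a ~ s → a′ ~ s)
    improve {a} {l} a∈A Ml with tri a l
    ... | inj₁ refl = case trans (sym a∈A) (proj₁ Ml) of λ ()
    ... | inj₂ (inj₁ a~l) = inj₁ a~l
    ... | inj₂ (inj₂ a≁l) with common a∈A Ml a≁l
    ... | y , y∈A , y~l , a~y = inj₂ (y , y∈A , y~l , keep)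
      where
      -- If `y` lost `s`, the square `s l y a` would carry the roof `c` over `s l`; here `s ~ l`
      -- because `L` is a clique.
      keep : ∀ {s} → Mixed s → a ~ s → y ~ s
      keep {s} Ms a~s with tri y s | tri s l
      ... | inj₁ refl | _ = case trans (sym y∈A) (proj₁ Ms) of λ ()
      ... | inj₂ (inj₁ p) | _ = p
      ... | _ | inj₁ refl = ⊥-elim (~∧≁ a~s a≁l)
      ... | _ | inj₂ (inj₂ s≁l) = ⊥-elim (clique Ms Ml s≁l)
      ... | inj₂ (inj₂ y≁s) | inj₂ (inj₁ s~l) = ⊥-elim
        (house s~l (~-sym y~l) (~-sym a~y) a~s (~-sym (L-C Ms Cc)) (~-sym (L-C Ml Cc)) (≁-sym y≁s) (≁-sym a≁l) (anti-c y∈A) (anti-c a∈A))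
  ... | a , a∈A , a-L = record
    { part = part
    ; A-B = λ x y → ~-sym (spec {pB} y (spec {pA} x))
    ; A-T = λ x y → ≁-sym (proj₁ (spec {pT} y) (spec {pA} x))
    ; A-C = λ x y → ≁-sym (proj₁ (spec {pC} y) (spec {pA} x))
    ; C-T = λ x y → active-isolated (spec {pC} x) (spec {pT} y)
    ; L-B = λ x y → L-B (spec {pL} x) (spec {pB} y)
    ; L-C = λ x y → L-C (spec {pL} x) (spec {pC} y)
    ; L-L = λ x y x≢y → [ (λ p → p) , (λ q → ⊥-elim (clique (spec {pL} x) (spec {pL} y) q)) ]′ (adjacency x≢y)
    ; T-T = λ x y → Isolated-T (spec {pT} x) (proj₁ (spec {pT} y))
    ; a = a ; a∈A = in-A a∈A ; a-L = λ l → a-L (spec {pL} l)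
    ; a′ = proj₁ second ; a′∈A = in-A (proj₁ (proj₂ second)) ; a′≢a = proj₂ (proj₂ second)
    ; c = c ; c∈C = in-C u₁∈A Cc ; c-B = λ b → c-B (spec {pB} b)
    ; c′ = c′ ; c′∈C = in-C u₁∈A (anti-c′ , c , anti-c , ~-sym c~c′) ; c′≢c = ~⇒≢ (~-sym c~c′)
    ; C-unmixed = λ x b b′ → unmixed (spec {pC} x) (spec {pB} b) (spec {pB} b′)
    }
    where
    second : ∃ λ a′ → A a′ ≡ true × a′ ≢ a
    second with a ≟ u₁
    ... | yes refl = u₂ , u₂∈A , λ e → u₁≢u₂ (sym e)
    ... | no a≢u₁ = u₁ , u₁∈A , λ e → a≢u₁ (sym e)
    active-isolated : ∀ {x y} → Active x → Isolated y → x ≁ y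
    active-isolated (anti-x , z , anti-z , x~z) Ty@(_ , iso) =
      ≁-sym (Isolated-T Ty anti-x λ { refl → iso anti-z x~z })

does-true : ∀ {p} {P : Set p} (P? : Dec P) → does P? ≡ true → P
does-true (yes p) _ = p

-- Conditions forced by a maximal connected set

module Maximal (S : Structure) (A : Structure.Vertex S → Bool) where
  open Structure S
  open Basics S
  open Sides S A

  module _
    (conn : Connected A) {u₁ u₂ : Vertex} (u₁∈A : A u₁ ≡ true) (u₂∈A : A u₂ ≡ true) (u₁≢u₂ : u₁ ≢ u₂)
    (some-active : ∃ Active)
    (hits : ∀ {n x y} → A n ≡ false → (∃ λ a → A a ≡ true × n ~ a) → Anti x → Anti y → x ~ y → n ~ x ⊎ n ~ y)
    where

    c₀ : Vertex
    c₀ = proj₁ some-active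

    c₀-active : Active c₀
    c₀-active = proj₂ some-active

    ∈-∉ : ∀ {x y} → A x ≡ true → A y ≡ false → x ≢ y
    ∈-∉ x∈A y∉A refl = case trans (sym x∈A) y∉A of λ ()

    B-hits : ∀ {b x} → Complete b → ((_ , y , _) : Active x) → b ~ x ⊎ b ~ y
    B-hits compl (anti , y , anti-y , x~y) = hits (Complete⇒∉ compl) (u₁ , u₁∈A , compl u₁∈A) anti anti-y x~y

    Active-sym : ∀ {x} ((_ , y , _) : Active x) → Active y
    Active-sym {x} (anti , y , anti-y , x~y) = anti-y , x , anti , ~-sym x~y

    -- Connectedness of `A`, applied to the cut into neighbours and non-neighbours of `l`.
    mixed-edge : ∀ {l} → Mixed l → ∃₂ λ a a′ → A a ≡ true × A a′ ≡ true × l ~ a × l ≁ a′ × a ~ a′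
    mixed-edge {l} (l∉A , (a , a∈A , l~a) , (a′ , a′∈A , l≁a′)) =
      conn {P = l ~_} {Q = l ≁_} (λ x∈A → adjacency λ e → ∈-∉ x∈A l∉A (sym e)) ~∧≁ a∈A l~a a′∈A l≁a′

    -- By `hits`, `l` meets the edge from `c` to `c′`. If only at `c′`, an edge `a ~ a′` split by
    -- `l` gives the induced path `a′ a l c′ c`.
    L-C : ∀ {l c} → Mixed l → Active c → l ~ c
    L-C {l} {c} Ml@(l∉A , nbr@(a , a∈A , l~a) , _) (anti , c′ , anti-c′ , c~c′) with tri l c
    ... | inj₁ refl = ⊥-elim (~∧≁ l~a (anti a∈A))
    ... | inj₂ (inj₁ p) = p
    ... | inj₂ (inj₂ l≁c) with hits l∉A nbr anti anti-c′ c~c′ | mixed-edge Ml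
    ... | inj₁ l~c | _ = ⊥-elim (~∧≁ l~c l≁c)
    ... | inj₂ l~c′ | a , a′ , a∈A , a′∈A , l~a , l≁a′ , a~a′ = ⊥-elim
      (p5 (~-sym a~a′) (~-sym l~a) l~c′ (~-sym c~c′)
          (≁-sym l≁a′) (≁-sym (anti-c′ a′∈A)) (≁-sym (anti a′∈A)) (≁-sym (anti-c′ a∈A)) (≁-sym (anti a∈A)) l≁c)

    -- Some active `c` is adjacent to `b`, and `l ~ c` by `L-C`. For an edge `a ~ a′` split by `l`,
    -- the square `a b c l` has the roof `a′` over `a b` unless `l ~ b`.
    L-B : ∀ {l b} → Mixed l → Complete b → l ~ b
    L-B {l} {b} Ml@(l∉A , _ , (a , a∈A , l≁a)) Cb with tri l b
    ... | inj₁ refl = ⊥-elim (~∧≁ (Cb a∈A) l≁a)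
    ... | inj₂ (inj₁ p) = p
    ... | inj₂ (inj₂ l≁b) = [ absurd c₀-active , absurd (Active-sym c₀-active) ]′ (B-hits Cb c₀-active)
      where
      absurd : ∀ {c} → Active c → b ~ c → l ~ b
      absurd Cc@(anti , _) b~c with mixed-edge Ml
      ... | a , a′ , a∈A , a′∈A , l~a , l≁a′ , a~a′ = ⊥-elim
        (house (~-sym (Cb a∈A)) b~c (~-sym (L-C Ml Cc)) l~a (~-sym a~a′) (~-sym (Cb a′∈A))
               (≁-sym (anti a∈A)) (≁-sym l≁b) (≁-sym (anti a′∈A)) (≁-sym l≁a′))

    -- If `x ≁ b′`, then `b′` meets the edge from `x` to `y` at `y`. The case `y ~ b` gives the
    -- square `b y b′ u₁` with roof `x` over `b y`; the case `y ≁ b` gives the 5-cycle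
    -- `u₁ b x y b′`.
    C-unmixed : ∀ {x b b′} → Active x → Complete b → Complete b′ → b ≁ b′ → x ~ b → x ~ b′
    C-unmixed {x} {b} {b′} Cx@(anti , y , anti-y , x~y) Cb Cb′ b≁b′ x~b with tri x b′ | B-hits Cb′ Cx | tri y b
    ... | inj₁ refl | _ | _ = ⊥-elim (~∧≁ (Cb′ u₁∈A) (anti u₁∈A))
    ... | inj₂ (inj₁ p) | _ | _ = p
    ... | _ | inj₁ p | _ = ~-sym p
    ... | _ | _ | inj₁ refl = ⊥-elim (~∧≁ (Cb u₁∈A) (anti-y u₁∈A))
    ... | inj₂ (inj₂ x≁b′) | inj₂ b′~y | inj₂ (inj₁ y~b) = ⊥-elim
      (house (~-sym y~b) (~-sym b′~y) (Cb′ u₁∈A) (~-sym (Cb u₁∈A)) x~b x~y b≁b′ (anti-y u₁∈A) x≁b′ (anti u₁∈A))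
    ... | inj₂ (inj₂ x≁b′) | inj₂ b′~y | inj₂ (inj₂ y≁b) = ⊥-elim
      (c5 (~-sym (Cb u₁∈A)) (~-sym x~b) x~y (~-sym b′~y) (Cb′ u₁∈A)
          (≁-sym (anti u₁∈A)) (≁-sym (anti-y u₁∈A)) (≁-sym y≁b) b≁b′ x≁b′)

    Complete? : ∀ x → Dec (Complete x)
    Complete? = Sides.Anti? (swap S) A

    -- When `c` misses `b`, its neighbour `c′` reaches `b` by `B-hits`. A neighbour `s` of `c` in
    -- `B` lost by `c′` is adjacent to `b` by `C-unmixed`, and then the square `s b c′ c` has the
    -- roof `u₁` over `s b`.
    c-B : ∃ λ c → Active c × (∀ {b} → Complete b → c ~ b)
    c-B = gather Complete? some-active improve
      where
      improve : ∀ {c b} → Active c → Complete b →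
        c ~ b ⊎ ∃ λ c′ → Active c′ × c′ ~ b × (∀ {s} → Complete s → c ~ s → c′ ~ s)
      improve {c} {b} Cc@(anti , c′ , anti-c′ , c~c′) Cb with tri c b
      ... | inj₁ refl = ⊥-elim (~∧≁ (Cb u₁∈A) (anti u₁∈A))
      ... | inj₂ (inj₁ p) = inj₁ p
      ... | inj₂ (inj₂ c≁b) with B-hits Cb Cc
      ... | inj₁ b~c = inj₁ (~-sym b~c)
      ... | inj₂ b~c′ = inj₂ (c′ , Active-sym Cc , ~-sym b~c′ , keep)
        where
        keep : ∀ {s} → Complete s → c ~ s → c′ ~ s
        keep {s} Cs c~s with tri c′ s | tri s b
        ... | inj₁ refl | _ = ⊥-elim (~∧≁ (Cs u₁∈A) (anti-c′ u₁∈A))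
        ... | inj₂ (inj₁ p) | _ = p
        ... | _ | inj₁ refl = ⊥-elim (~∧≁ c~s c≁b)
        ... | _ | inj₂ (inj₂ s≁b) = ⊥-elim (~∧≁ (C-unmixed Cc Cs Cb s≁b c~s) c≁b)
        ... | inj₂ (inj₂ c′≁s) | inj₂ (inj₁ s~b) = ⊥-elim
          (house s~b b~c′ (~-sym c~c′) c~s (~-sym (Cs u₁∈A)) (~-sym (Cb u₁∈A))
                 (≁-sym c′≁s) (≁-sym c≁b) (≁-sym (anti-c′ u₁∈A)) (≁-sym (anti u₁∈A)))

    divide-if-clique : (∀ {x y} → Mixed x → Mixed y → ¬ x ≁ y) → Divide _~_ _≁_
    divide-if-clique clique = divide conn u₁∈A u₂∈A u₁≢u₂ clique L-B L-C c-B C-unmixed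

    -- The set `M`: all of `L`, and the vertices of `B` complete to `C`

    M : Vertex → Set
    M n = A n ≡ false × (∃ λ a → A a ≡ true × n ~ a) × (∀ {c} → Active c → n ~ c)

    Mixed⇒M : ∀ {l} → Mixed l → M l
    Mixed⇒M Ml@(l∉A , nbr , _) = l∉A , nbr , L-C Ml

    M⇒¬Anti : ∀ {x} → M x → ¬ Anti x
    M⇒¬Anti (_ , (a , a∈A , x~a) , _) anti = ~∧≁ x~a (anti a∈A)

    M-cases : ∀ {x} → M x → Complete x ⊎ Mixed x
    M-cases {x} Mx@(x∉A , _) with classify x
    ... | pA , x∈A = case trans (sym x∈A) x∉A of λ ()
    ... | pB , Cx = inj₁ λ {a} → Cx {a}
    ... | pC , anti , _ = ⊥-elim (M⇒¬Anti Mx anti)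
    ... | pL , Lx = inj₂ Lx
    ... | pT , anti , _ = ⊥-elim (M⇒¬Anti Mx anti)

    M? : ∀ x → Dec (M x)
    M? x with classify x
    ... | pA , x∈A = no λ (x∉A , _) → case trans (sym x∈A) x∉A of λ ()
    ... | pC , anti , _ = no λ Mx → M⇒¬Anti Mx anti
    ... | pL , Lx = yes (Mixed⇒M Lx)
    ... | pT , anti , _ = no λ Mx → M⇒¬Anti Mx anti
    ... | pB , Cx with omniscience toC
      where
      toC : ∀ c → (Active c → x ~ c) ⊎ ¬ (Active c → x ~ c)
      toC c with classify c | tri x c
      ... | _ | inj₂ (inj₁ p) = inj₁ λ _ → p
      ... | pC , Cc | inj₁ refl = inj₂ λ f → ~-irr (f Cc)
      ... | pC , Cc | inj₂ (inj₂ q) = inj₂ λ f → ~∧≁ (f Cc) q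
      ... | pA , c∈A | _ = inj₁ λ (anti , _) → ⊥-elim (≁-irr (anti c∈A))
      ... | pB , Bc | _ = inj₁ λ (anti , _) → ⊥-elim (~∧≁ (Bc u₁∈A) (anti u₁∈A))
      ... | pL , (_ , (a , a∈A , c~a) , _) | _ = inj₁ λ (anti , _) → ⊥-elim (~∧≁ c~a (anti a∈A))
      ... | pT , _ , iso | _ = inj₁ λ (_ , y , anti-y , c~y) → ⊥-elim (iso anti-y c~y)
    ... | inj₁ all = yes (Complete⇒∉ Cx , (u₁ , u₁∈A , Cx u₁∈A) , λ {c} → all c)
    ... | inj₂ (c , ¬c) = no λ (_ , _ , f) → ¬c f

    -- All other adjacencies of `l` to the edge are obstructions through `c₀`: with both ends, the
    -- square `l x l′ c₀` roofed by `x′`; with `x′` alone, the 5-cycle `x l′ c₀ l x′`; with neither,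
    -- the path `x′ x l′ c₀ l`.
    twin-edge : ∀ {l l′ x x′} → Mixed l → Mixed l′ → l ≁ l′ → A x ≡ true → A x′ ≡ true → x ~ x′ →
      l′ ~ x → l′ ≁ x′ → l ~ x × l ≁ x′
    twin-edge {l} {l′} {x} {x′} Ml Ml′ l≁l′ x∈A x′∈A x~x′ l′~x l′≁x′
      with adjacency (λ e → ∈-∉ x∈A (proj₁ Ml) (sym e)) | adjacency (λ e → ∈-∉ x′∈A (proj₁ Ml) (sym e))
         | L-C Ml c₀-active | L-C Ml′ c₀-active | proj₁ c₀-active x∈A | proj₁ c₀-active x′∈A
    ... | inj₁ p | inj₂ q | _ | _ | _ | _ = p , q
    ... | inj₁ l~x | inj₁ l~x′ | l~c | l′~c | c≁x | c≁x′ = ⊥-elim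
      (house l~x (~-sym l′~x) l′~c (~-sym l~c) (~-sym l~x′) (~-sym x~x′) l≁l′ (≁-sym c≁x) (≁-sym l′≁x′) (≁-sym c≁x′))
    ... | inj₂ l≁x | inj₁ l~x′ | l~c | l′~c | c≁x | c≁x′ = ⊥-elim
      (c5 (~-sym l′~x) l′~c (~-sym l~c) l~x′ (~-sym x~x′) (≁-sym c≁x) (≁-sym l≁x) (≁-sym l≁l′) l′≁x′ c≁x′)
    ... | inj₂ l≁x | inj₂ l≁x′ | l~c | l′~c | c≁x | c≁x′ = ⊥-elim
      (p5 (~-sym x~x′) (~-sym l′~x) l′~c (~-sym l~c) (≁-sym l′≁x′) (≁-sym c≁x′) (≁-sym l≁x′) (≁-sym c≁x) (≁-sym l≁x) (≁-sym l≁l′))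

    -- Cut `A` into the vertices on which `l` and `l′` agree and those on which they differ. On an
    -- edge crossing this cut exactly one of the two distinguishes the ends, against `twin-edge`.
    -- Agreement does occur: `l′` splits some edge of `A`, and `l` follows it there.
    Mixed-twins : ∀ {l l′ y} → Mixed l → Mixed l′ → l ≁ l′ → A y ≡ true → l ~ y → l′ ~ y
    Mixed-twins {l} {l′} {y} Ml Ml′ l≁l′ y∈A l~y with adjacency {l′} {y} (λ e → ∈-∉ y∈A (proj₁ Ml′) (sym e)) | mixed-edge Ml′
    ... | inj₁ p | _ = p
    ... | inj₂ l′≁y | x , x′ , x∈A , x′∈A , l′~x , l′≁x′ , x~x′
        with conn {P = λ v → l ~ v × l′ ~ v ⊎ l ≁ v × l′ ≁ v} {Q = λ v → l ~ v × l′ ≁ v ⊎ l ≁ v × l′ ~ v} compare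
               (λ { (inj₁ (p , q)) (inj₁ (r , s)) → ~∧≁ q s ; (inj₁ (p , q)) (inj₂ (r , s)) → ~∧≁ p r
                  ; (inj₂ (p , q)) (inj₁ (r , s)) → ~∧≁ r p ; (inj₂ (p , q)) (inj₂ (r , s)) → ~∧≁ s q })
               x∈A (inj₁ (proj₁ (twin-edge Ml Ml′ l≁l′ x∈A x′∈A x~x′ l′~x l′≁x′) , l′~x)) y∈A (inj₁ (l~y , l′≁y))
        where
        compare : ∀ {v} → A v ≡ true → (l ~ v × l′ ~ v ⊎ l ≁ v × l′ ≁ v) ⊎ (l ~ v × l′ ≁ v ⊎ l ≁ v × l′ ~ v)
        compare v∈A with adjacency (λ e → ∈-∉ v∈A (proj₁ Ml) (sym e)) | adjacency (λ e → ∈-∉ v∈A (proj₁ Ml′) (sym e))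
        ... | inj₁ p | inj₁ q = inj₁ (inj₁ (p , q))
        ... | inj₂ p | inj₂ q = inj₁ (inj₂ (p , q))
        ... | inj₁ p | inj₂ q = inj₂ (inj₁ (p , q))
        ... | inj₂ p | inj₁ q = inj₂ (inj₂ (p , q))
    ... | u , v , u∈A , v∈A , inj₁ (l~u , l′~u) , inj₁ (l~v , l′≁v) , u~v =
      ⊥-elim (~∧≁ l~v (proj₂ (twin-edge Ml Ml′ l≁l′ u∈A v∈A u~v l′~u l′≁v)))
    ... | u , v , u∈A , v∈A , inj₁ (l~u , l′~u) , inj₂ (l≁v , l′~v) , u~v =
      ⊥-elim (~∧≁ l′~v (proj₂ (twin-edge Ml′ Ml (≁-sym l≁l′) u∈A v∈A u~v l~u l≁v)))
    ... | u , v , u∈A , v∈A , inj₂ (l≁u , l′≁u) , inj₁ (l~v , l′≁v) , u~v =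
      ⊥-elim (~∧≁ (proj₁ (twin-edge Ml′ Ml (≁-sym l≁l′) v∈A u∈A (~-sym u~v) l~v l≁u)) l′≁v)
    ... | u , v , u∈A , v∈A , inj₂ (l≁u , l′≁u) , inj₂ (l≁v , l′~v) , u~v =
      ⊥-elim (~∧≁ (proj₁ (twin-edge Ml Ml′ l≁l′ v∈A u∈A (~-sym u~v) l′~v l′≁u)) l≁v)

    -- Beyond `Mixed-twins`, a pair with one vertex in `B` and the other in `L` is adjacent by
    -- `L-B`, and vertices of `B` see all of `A`.
    M-twins : ∀ {p p′ y} → M p → M p′ → p ≁ p′ → A y ≡ true → p ~ y → p′ ~ y
    M-twins Mp Mp′ p≁p′ y∈A p~y with M-cases Mp | M-cases Mp′
    ... | _ | inj₁ Cp′ = Cp′ y∈A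
    ... | inj₁ Cp | inj₂ Lp′ = ⊥-elim (~∧≁ (L-B Lp′ Cp) (≁-sym p≁p′))
    ... | inj₂ Lp | inj₂ Lp′ = Mixed-twins Lp Lp′ p≁p′ y∈A p~y

    -- The union of `A` and `T`. It is anticomplete to `C`, and by `undominating` it contains every
    -- vertex outside the chosen anticomponent that misses some vertex of it.
    Flat : Vertex → Set
    Flat x = A x ≡ true ⊎ Isolated x

    Flat-¬M : ∀ {x} → Flat x → ¬ M x
    Flat-¬M (inj₁ x∈A) (x∉A , _) = case trans (sym x∈A) x∉A of λ ()
    Flat-¬M (inj₂ (anti , _)) Mx = M⇒¬Anti Mx anti

    Flat-Active : ∀ {x c} → Flat x → Active c → x ≁ c
    Flat-Active (inj₁ x∈A) (anti , _) = ≁-sym (anti x∈A)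
    Flat-Active (inj₂ Tx@(_ , iso)) (anti , y , anti-y , c~y) =
      Isolated-T Tx anti λ { refl → iso anti-y c~y }

    Flat-Isolated : ∀ {x t} → Flat x → Isolated t → x ≢ t → x ≁ t
    Flat-Isolated (inj₁ x∈A) (anti , _) _ = ≁-sym (anti x∈A)
    Flat-Isolated (inj₂ Tx) (anti , _) x≢t = Isolated-T Tx anti x≢t

    Flat? : ∀ x → Dec (Flat x)
    Flat? x with classify x
    ... | pA , x∈A = yes (inj₁ x∈A)
    ... | pT , Tx = yes (inj₂ Tx)
    ... | pB , Bx = no [ (λ x∈A → ~-irr (Bx x∈A)) , (λ (anti , _) → ~∧≁ (Bx u₁∈A) (anti u₁∈A)) ]′
    ... | pC , anti , y , anti-y , x~y = no [ (λ x∈A → ≁-irr (anti x∈A)) , (λ (_ , iso) → iso anti-y x~y) ]′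
    ... | pL , Lx = no λ f → Flat-¬M f (Mixed⇒M Lx)

    module Co = Basics (swap S)

    -- Says that the anticomponent of `p` in `M` has at least two vertices. This is needed for it to
    -- take the place of `A`, whose contraction must give a smaller graph.
    record NonSingle (p : Vertex) : Set where
      constructor nonSingle
      field
        {partner} : Vertex
        p∈M       : M p
        partner∈M : M partner
        p≁partner : p ≁ partner

    module CoComponent {p} (K : Co.Component M p) where
      open Co.Component K public

      Dominates : Vertex → Set
      Dominates x = ∀ {q} → mem q ≡ true → x ~ q

      -- Connectedness is that of the complement, so the pair crossing the cut by the neighbourhood
      -- of `x` is a non-edge.
      distinguishing-pair : ∀ {x u v} → mem x ≡ false → mem u ≡ true → x ~ u → mem v ≡ true → x ≁ v →
        ∃₂ λ y z → mem y ≡ true × mem z ≡ true × x ~ y × x ≁ z × y ≁ z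
      distinguishing-pair {x} x∉ u∈ x~u v∈ x≁v =
        connected {P = x ~_} {Q = x ≁_} (λ y∈ → adjacency λ { refl → case trans (sym y∈) x∉ of λ () }) ~∧≁ u∈ x~u v∈ x≁v

      -- A vertex of `A` mixed on the anticomponent would distinguish two of its nonadjacent
      -- vertices, which `M-twins` forbids.
      A-uniform : ∀ {a u v} → A a ≡ true → mem u ≡ true → a ~ u → mem v ≡ true → a ~ v
      A-uniform {a} {u} {v} a∈A u∈ a~u v∈ with tri a v
      ... | inj₁ refl = ⊥-elim (Flat-¬M (inj₁ a∈A) (inside v∈))
      ... | inj₂ (inj₁ p) = p
      ... | inj₂ (inj₂ a≁v) with mem a in eq
      ... | true = ⊥-elim (Flat-¬M (inj₁ a∈A) (inside eq))
      ... | false with distinguishing-pair eq u∈ a~u v∈ a≁v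
      ... | y , z , y∈ , z∈ , a~y , a≁z , y≁z =
        ⊥-elim (~∧≁ (~-sym (M-twins (inside y∈) (inside z∈) y≁z a∈A (~-sym a~y))) a≁z)

      M-dominates : ∀ {x} → M x → mem x ≡ false → Dominates x
      M-dominates {x} Mx x∉ {q} q∈ with tri x q
      ... | inj₁ refl = case trans (sym q∈) x∉ of λ ()
      ... | inj₂ (inj₁ p) = p
      ... | inj₂ (inj₂ x≁q) = case trans (sym (closed q∈ Mx (≁-sym x≁q))) x∉ of λ ()

      Dominates⇒∉ : ∀ {x} → Dominates x → mem x ≡ false
      Dominates⇒∉ {x} dom with mem x in eq
      ... | true = ⊥-elim (~-irr (dom eq))
      ... | false = refl

      Dominates? : ∀ x → Dec (Dominates x)
      Dominates? = Sides.Anti? (swap S) mem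

      FlatDominates : Vertex → Set
      FlatDominates x = Flat x × Dominates x

      FlatDominates? : ∀ x → Dec (FlatDominates x)
      FlatDominates? x = Flat? x ×-dec Dominates? x

    -- Deciding `M p` afresh makes the component independent of the given proof, so that it
    -- coincides with the one measured by `weight`.
    comp : ∀ {p} → M p → Co.Component M p
    comp {p} Mp with M? p
    ... | yes Mp′ = Co.component M? Mp′
    ... | no ¬Mp = contradiction Mp ¬Mp

    FlatMaximal : ∀ {q} → Co.Component M q → Set
    FlatMaximal K = ∀ {z} (z-nonsingle : NonSingle z) → let K′ = comp (NonSingle.p∈M z-nonsingle) in
      (∀ {x} → CoComponent.FlatDominates K x → CoComponent.FlatDominates K′ x) →
      (∀ {x} → CoComponent.FlatDominates K′ x → CoComponent.FlatDominates K x)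

    -- The partition of the complement around the chosen anticomponent

    module Candidate {q} (K : Co.Component M q) (q-nonsingle : NonSingle q)
      (maximal : FlatMaximal K)
      where
      open CoComponent K
      -- Read in the original graph, `CoSides.Complete` means anticomplete to `mem`, and the
      -- vertices of `CoSides.Active` and `CoSides.Isolated` are complete to `mem`.
      module CoSides = Sides (swap S) mem

      -- Suppose `b ≁ x` with `x` in the anticomponent. By `L-B`, `x` lies in `B`, and `C-unmixed`
      -- passes completeness to `C` from `x` to `b`. So `b` is in `M` and would belong to the
      -- anticomponent.
      Complete-dominates : ∀ {b} → Complete b → mem b ≡ false → Dominates b
      Complete-dominates {b} Cb b∉ {x} x∈ with tri b x
      ... | inj₁ refl = case trans (sym x∈) b∉ of λ ()
      ... | inj₂ (inj₁ p) = p
      ... | inj₂ (inj₂ b≁x) with M-cases (inside x∈)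
      ... | inj₂ Lx = ~-sym (L-B Lx Cb)
      ... | inj₁ Cx = M-dominates Mb b∉ x∈
        where
        Mb : M b
        Mb = Complete⇒∉ Cb , (u₁ , u₁∈A , Cb u₁∈A)
           , λ Cc → ~-sym (C-unmixed Cc Cx Cb (≁-sym b≁x) (~-sym (proj₂ (proj₂ (inside x∈)) Cc)))

      Active-dominates : ∀ {c} → Active c → Dominates c
      Active-dominates Cc x∈ = ~-sym (proj₂ (proj₂ (inside x∈)) Cc)

      undominating : ∀ {x y} → mem x ≡ false → mem y ≡ true → x ≁ y → Flat x
      undominating {x} x∉ y∈ x≁y with classify x
      ... | pA , x∈A = inj₁ x∈A
      ... | pT , Tx = inj₂ Tx
      ... | pB , Bx = ⊥-elim (~∧≁ (Complete-dominates Bx x∉ y∈) x≁y)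
      ... | pC , Cx = ⊥-elim (~∧≁ (Active-dominates Cx y∈) x≁y)
      ... | pL , Lx = ⊥-elim (~∧≁ (M-dominates (Mixed⇒M Lx) x∉ y∈) x≁y)

      co-complete-Flat : ∀ {x} → CoSides.Complete x → Flat x
      co-complete-Flat {x} anti with mem x in eq
      ... | true = ⊥-elim (≁-irr (anti eq))
      ... | false = undominating eq root (anti root)

      co-mixed-Isolated : ∀ {x} → CoSides.Mixed x → Isolated x
      co-mixed-Isolated (x∉ , (u , u∈ , x≁u) , (v , v∈ , x~v)) with undominating x∉ u∈ x≁u
      ... | inj₁ x∈A = ⊥-elim (~∧≁ (A-uniform x∈A v∈ x~v u∈) x≁u)
      ... | inj₂ Tx = Tx

      L-L : ∀ {x y} → CoSides.Mixed x → CoSides.Mixed y → ¬ x ~ y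
      L-L Mx My with co-mixed-Isolated Mx | co-mixed-Isolated My
      ... | _ , iso | anti , _ = iso anti

      co-L-B : ∀ {x y} → CoSides.Mixed x → CoSides.Complete y → x ≁ y
      co-L-B {x} {y} Mx@(_ , _ , (v , v∈ , x~v)) anti =
        ≁-sym (Flat-Isolated (co-complete-Flat anti) (co-mixed-Isolated Mx) λ { refl → ~∧≁ x~v (anti v∈) })

      -- If the two anticomponents met, `K′`, which contains the outside vertex `z`, would have a
      -- non-edge leading out of `mem`, against `closed`.
      other-avoids : ∀ {z} (K′ : Co.Component M z) → Dominates z → ∀ {p} → Co.Component.mem K′ p ≡ true → mem p ≡ false
      other-avoids {z} K′ z-dom {p} p∈′ with mem p in eq
      ... | false = refl
      ... | true with CoComponent.connected K′ {P = λ x → mem x ≡ true} {Q = λ x → mem x ≡ false} split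
                        (λ t f → case trans (sym t) f of λ ()) p∈′ eq (CoComponent.root K′) (Dominates⇒∉ z-dom)
        where
        split : ∀ {x} → Co.Component.mem K′ x ≡ true → mem x ≡ true ⊎ mem x ≡ false
        split {x} _ with mem x
        ... | true = inj₁ refl
        ... | false = inj₂ refl
      ... | u , v , _ , v∈′ , u∈ , v∉ , u≁v =
        case trans (sym (closed u∈ (CoComponent.inside K′ v∈′) u≁v)) v∉ of λ ()

      other-dominates : ∀ {z} (K′ : Co.Component M z) → Dominates z → ∀ {p} → Co.Component.mem K′ p ≡ true → Dominates p
      other-dominates K′ z-dom p∈′ = M-dominates (CoComponent.inside K′ p∈′) (other-avoids K′ z-dom p∈′)

      -- If `t ~ z`, then `z` and `z₂` both lie in `M`, in one anticomponent `K′`. Every flat vertex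
      -- complete to `mem` is complete to `K′`, and so is `t`, which is mixed on `mem`: a
      -- contradiction to `maximal`.
      co-L-C : ∀ {t z} → CoSides.Mixed t → CoSides.Active z → t ≁ z
      co-L-C {t} {z} Mt@(t∉ , (u , u∈ , t≁u) , (v , v∈ , t~v)) (z-dom , z₂ , z₂-dom , z≁z₂)
        with adjacency {t} {z} (λ { refl → ~∧≁ (z-dom u∈) t≁u })
      ... | inj₂ q = q
      ... | inj₁ t~z = ⊥-elim contra
        where
        Tt : Isolated t
        Tt = co-mixed-Isolated Mt

        -- Nonadjacent `l` and `l′` of the anticomponent distinguished by `t` form the square
        -- `x l y l′`, with `t` as roof over `x l`.
        avoids : ∀ {x y} → Dominates x → Dominates y → x ≁ y → t ~ x → ¬ t ≁ y
        avoids x-dom y-dom x≁y t~x t≁y with distinguishing-pair t∉ v∈ t~v u∈ t≁u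
        ... | l , l′ , l∈ , l′∈ , t~l , t≁l′ , l≁l′ =
          house (x-dom l∈) (~-sym (y-dom l∈)) (y-dom l′∈) (~-sym (x-dom l′∈)) t~x t~l x≁y l≁l′ t≁y t≁l′

        -- A vertex of `C` missed by `x` would be a neighbour of `t` by `avoids`. And `x` has a
        -- neighbour in `A`, since `t` is isolated among the vertices anticomplete to `A`.
        neighbour-M : ∀ {x} → Dominates x → t ~ x → M x
        neighbour-M {x} x-dom t~x = x∉A , nbr , x-C
          where
          x-C : ∀ {c} → Active c → x ~ c
          x-C {c} Cc with tri x c
          ... | inj₁ refl = ⊥-elim (~∧≁ t~x (Flat-Active (inj₂ Tt) Cc))
          ... | inj₂ (inj₁ p) = p
          ... | inj₂ (inj₂ x≁c) = ⊥-elim (avoids x-dom (Active-dominates Cc) x≁c t~x (Flat-Active (inj₂ Tt) Cc))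
          x∉A : A x ≡ false
          x∉A with A x in eq
          ... | false = refl
          ... | true = ⊥-elim (~∧≁ t~x (proj₁ Tt eq))
          nbr : ∃ λ a → A a ≡ true × x ~ a
          nbr with classify x
          ... | pA , x∈A = ⊥-elim (~∧≁ t~x (proj₁ Tt x∈A))
          ... | pB , Bx = u₁ , u₁∈A , Bx u₁∈A
          ... | pC , anti , _ = ⊥-elim (proj₂ Tt anti t~x)
          ... | pL , _ , nbr , _ = nbr
          ... | pT , anti , _ = ⊥-elim (proj₂ Tt anti t~x)

        t~z₂ : t ~ z₂
        t~z₂ with adjacency {t} {z₂} (λ { refl → ~∧≁ (z₂-dom u∈) t≁u })
        ... | inj₁ p = p
        ... | inj₂ t≁z₂ = ⊥-elim (avoids z-dom z₂-dom z≁z₂ t~z t≁z₂)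

        K′ : Co.Component M z
        K′ = comp (neighbour-M z-dom t~z)
        module K′ = CoComponent K′

        t-dominates : K′.Dominates t
        t-dominates {p} p∈ with tri t p
        ... | inj₁ refl = ⊥-elim (Flat-¬M (inj₂ Tt) (K′.inside p∈))
        ... | inj₂ (inj₁ q) = q
        ... | inj₂ (inj₂ t≁p) with K′.mem t in eq
        ... | true = ⊥-elim (Flat-¬M (inj₂ Tt) (K′.inside eq))
        ... | false with K′.distinguishing-pair eq K′.root t~z p∈ t≁p
        ... | y , x , y∈ , x∈ , t~y , t≁x , y≁x =
          ⊥-elim (avoids (other-dominates K′ z-dom y∈) (other-dominates K′ z-dom x∈) y≁x t~y t≁x)

        -- If `d` missed `p`, the square `l p l′ d` would have the roof `t` over `l p`; `t` and `d`
        -- are nonadjacent because both are flat and `t` is isolated.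
        larger : ∀ {d} → FlatDominates d → K′.FlatDominates d
        larger {d} (Fd , d-dom) = Fd , dom
          where
          dom : K′.Dominates d
          dom {p} p∈ with tri d p | distinguishing-pair t∉ v∈ t~v u∈ t≁u
          ... | inj₁ refl | _ = ⊥-elim (Flat-¬M Fd (K′.inside p∈))
          ... | inj₂ (inj₁ q) | _ = q
          ... | inj₂ (inj₂ d≁p) | l , l′ , l∈ , l′∈ , t~l , t≁l′ , l≁l′ = ⊥-elim
            (house (~-sym (p-dom l∈)) (p-dom l′∈) (~-sym (d-dom l′∈)) (d-dom l∈) t~l (t-dominates p∈)
                   l≁l′ (≁-sym d≁p) t≁l′ (≁-sym (Flat-Isolated Fd Tt λ { refl → ~∧≁ (d-dom l′∈) t≁l′ })))
            where
            p-dom : Dominates p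
            p-dom = other-dominates K′ z-dom p∈

        contra : ⊥
        contra = ~∧≁ (proj₂ (maximal (nonSingle (neighbour-M z-dom t~z) (neighbour-M z₂-dom t~z₂) z≁z₂) larger
                                     (inj₂ Tt , t-dominates)) u∈) t≁u

      A-dominator : ∃ λ d → A d ≡ true × Dominates d
      A-dominator with inside root
      ... | _ , (d , d∈A , q~d) , _ = d , d∈A , A-uniform d∈A root (~-sym q~d)

      -- Any vertex of `C` serves, because the vertices anticomplete to `mem` are flat and hence
      -- anticomplete to `C`. Its partner in the complement is a vertex of `A` complete to `mem`.
      co-c-B : ∃ λ c → CoSides.Active c × (∀ {b} → CoSides.Complete b → c ≁ b)
      co-c-B with A-dominator
      ... | d , d∈A , d-dom = c₀
        , (Active-dominates c₀-active , d , d-dom , proj₁ c₀-active d∈A)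
        , λ anti → ≁-sym (Flat-Active (co-complete-Flat anti) c₀-active)

      -- If `d` misses both `u` and `v`, in particular if it is isolated, `d l p v u` is an induced
      -- path. If `d ~ v`, the square `l p v d` has the roof `c₀` over `l p`. If `d` sees `u` only,
      -- `d u v p l` is a 5-cycle.
      no-separator : ∀ {u v l p d} → A u ≡ true → A v ≡ true → u ~ v → l ≁ u → l ≁ v → (∀ {c} → Active c → l ~ c) →
        M p → p ~ l → p ~ v → p ≁ u → Flat d → d ~ l → ¬ d ≁ p
      no-separator {u} {v} {l} {p} {d} u∈A v∈A u~v l≁u l≁v l-C Mp p~l p~v p≁u Fd d~l d≁p with Fd
      ... | inj₂ (anti , _) = p5 d~l (~-sym p~l) p~v (~-sym u~v) d≁p (anti v∈A) (anti u∈A) l≁v l≁u p≁u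
      ... | inj₁ d∈A with adjacency {d} {v} (λ { refl → ~∧≁ d~l (≁-sym l≁v) }) | adjacency {d} {u} (λ { refl → ~∧≁ d~l (≁-sym l≁u) })
      ... | inj₁ d~v | _ = house (~-sym p~l) p~v (~-sym d~v) d~l (~-sym (l-C c₀-active)) (~-sym (proj₂ (proj₂ Mp) c₀-active))
                             l≁v (≁-sym d≁p) (proj₁ c₀-active v∈A) (proj₁ c₀-active d∈A)
      ... | inj₂ d≁v | inj₁ d~u = c5 d~u u~v (~-sym p~v) p~l (~-sym d~l) d≁v d≁p (≁-sym p≁u) (≁-sym l≁u) (≁-sym l≁v)
      ... | inj₂ d≁v | inj₂ d≁u = p5 d~l (~-sym p~l) p~v (~-sym u~v) d≁p d≁v d≁u l≁v l≁u p≁u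

      -- Suppose `z ~ v`. The edge `u v` lies in `A`. If `z` is in `A`, then `u v z q c₀` is an
      -- induced path, so `z` is left in `L`. Its non-neighbour `z₂` cannot be flat by
      -- `no-separator`; if it is also in `L`, the anticomponent of `z` has all the flat dominators
      -- of `mem` and `v` besides.
      co-C-unmixed : ∀ {z u v} → CoSides.Active z → CoSides.Complete u → CoSides.Complete v → u ~ v → z ≁ u → z ≁ v
      co-C-unmixed {z} {u} {v} (z-dom , z₂ , z₂-dom , z≁z₂) u-anti v-anti u~v z≁u
        with adjacency {z} {v} (λ { refl → ~∧≁ (~-sym u~v) z≁u }) | co-complete-Flat u-anti | co-complete-Flat v-anti
      ... | inj₂ q | _ | _ = q
      ... | inj₁ _ | inj₂ Tu | Fv = ⊥-elim (~∧≁ u~v (≁-sym (Flat-Isolated Fv Tu λ { refl → ~-irr u~v })))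
      ... | inj₁ _ | Fu | inj₂ Tv = ⊥-elim (~∧≁ u~v (Flat-Isolated Fu Tv λ { refl → ~-irr u~v }))
      ... | inj₁ z~v | inj₁ u∈A | inj₁ v∈A = ⊥-elim (by-side (classify z))
        where
        q-C : ∀ {c} → Active c → q ~ c
        q-C = proj₂ (proj₂ (inside root))

        separates : ∀ {p d} → M p → Dominates p → p ~ v → p ≁ u → Flat d → Dominates d → ¬ d ≁ p
        separates Mp p-dom p~v p≁u Fd d-dom =
          no-separator u∈A v∈A u~v (≁-sym (u-anti root)) (≁-sym (v-anti root)) q-C Mp (p-dom root) p~v p≁u Fd (d-dom root)

        larger-component : Mixed z → Mixed z₂ → ⊥
        larger-component Lz Lz₂ = ~∧≁ (proj₂ (maximal (nonSingle Mz (Mixed⇒M Lz₂) z≁z₂) larger (inj₁ v∈A , v-dom)) root) (v-anti root)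
          where
          Mz : M z
          Mz = Mixed⇒M Lz
          K′ : Co.Component M z
          K′ = comp Mz
          module K′ = CoComponent K′
          v-dom : K′.Dominates v
          v-dom = K′.A-uniform v∈A K′.root (~-sym z~v)
          larger : ∀ {d} → FlatDominates d → K′.FlatDominates d
          larger {d} (Fd , d-dom) = Fd , dom
            where
            dom : K′.Dominates d
            dom {p} p∈ with tri d p | adjacency {p} {u} (λ { refl → Flat-¬M (inj₁ u∈A) (K′.inside p∈) })
            ... | inj₁ refl | _ = ⊥-elim (Flat-¬M Fd (K′.inside p∈))
            ... | inj₂ (inj₁ r) | _ = r
            ... | _ | inj₁ p~u = ⊥-elim (~∧≁ (~-sym (K′.A-uniform u∈A p∈ (~-sym p~u) K′.root)) z≁u)
            ... | inj₂ (inj₂ d≁p) | inj₂ p≁u =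
              ⊥-elim (separates (K′.inside p∈) (other-dominates K′ z-dom p∈) (~-sym (v-dom p∈)) p≁u Fd d-dom d≁p)

        by-side : Σ[ p ∈ Part ] Spec p z → ⊥
        by-side (pA , z∈A) = p5 u~v (~-sym z~v) (z-dom root) (q-C c₀-active)
          (≁-sym z≁u) (u-anti root) (≁-sym (proj₁ c₀-active u∈A)) (v-anti root) (≁-sym (proj₁ c₀-active v∈A)) (≁-sym (proj₁ c₀-active z∈A))
        by-side (pB , Bz) = ~∧≁ (Bz u∈A) z≁u
        by-side (pC , anti , _) = ~∧≁ z~v (anti v∈A)
        by-side (pT , anti , _) = ~∧≁ z~v (anti v∈A)
        by-side (pL , Lz) with classify z₂
        ... | pA , z₂∈A = separates (Mixed⇒M Lz) z-dom z~v z≁u (inj₁ z₂∈A) z₂-dom (≁-sym z≁z₂)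
        ... | pT , Tz₂ = separates (Mixed⇒M Lz) z-dom z~v z≁u (inj₂ Tz₂) z₂-dom (≁-sym z≁z₂)
        ... | pB , Bz₂ = ~∧≁ (L-B Lz Bz₂) z≁z₂
        ... | pC , Cz₂ = ~∧≁ (L-C Lz Cz₂) z≁z₂
        ... | pL , Lz₂ = larger-component Lz Lz₂

      co-divide : Divide _≁_ _~_
      co-divide = CoSides.divide connected root (closed root partner∈M p≁partner) (≁⇒≢ p≁partner)
        L-L co-L-B co-L-C co-c-B co-C-unmixed
        where open NonSingle q-nonsingle

    NonSingle? : ∀ p → Dec (NonSingle p)
    NonSingle? p with M? p
    ... | no ¬Mp = no λ ns → ¬Mp (NonSingle.p∈M ns)
    ... | yes Mp with omniscience partner?
      where
      partner? : ∀ x → ¬ (M x × p ≁ x) ⊎ (M x × p ≁ x)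
      partner? x with M? x | tri p x
      ... | no ¬Mx | _ = inj₁ λ (Mx , _) → ¬Mx Mx
      ... | yes _ | inj₁ refl = inj₁ λ (_ , r) → ≁-irr r
      ... | yes _ | inj₂ (inj₁ r) = inj₁ λ (_ , r′) → ~∧≁ r r′
      ... | yes Mx | inj₂ (inj₂ r) = inj₂ (Mx , r)
    ... | inj₁ none = no λ ns → none _ (NonSingle.partner∈M ns , NonSingle.p≁partner ns)
    ... | inj₂ (_ , Mx , r) = yes (nonSingle Mp Mx r)

    dominators : ∀ {p} → Co.Component M p → Vertex → Bool
    dominators K x = does (CoComponent.FlatDominates? K x)

    -- Few misses mean many flat dominators, so a minimum yields a set of greatest size, which is
    -- maximal for inclusion. The value 0 outside `M` never enters the comparison, whose candidates
    -- all lie in `M`.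
    weight : Vertex → ℕ
    weight p with M? p
    ... | yes Mp = misses (dominators (Co.component M? Mp)) elems
    ... | no _ = 0

    weight-comp : ∀ {p} (Mp : M p) → weight p ≡ misses (dominators (comp Mp)) elems
    weight-comp {p} Mp with M? p
    ... | yes _ = refl
    ... | no ¬Mp = contradiction Mp ¬Mp

    co-divide-from : ∀ {p} → NonSingle p → Divide _≁_ _~_
    co-divide-from {p} p-nonsingle = Candidate.co-divide (comp q∈M) q-nonsingle maximal
      where
      candidates : List Vertex
      candidates = filter NonSingle? elems
      q : Vertex
      q = argmin weight p candidates
      q-nonsingle : NonSingle q
      q-nonsingle = argmin-all weight p-nonsingle (all-filter NonSingle? elems)
      q∈M : M q
      q∈M = NonSingle.p∈M q-nonsingle
      maximal : FlatMaximal (comp q∈M)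
      -- A flat dominator gained by the anticomponent of `z` would give `weight z < weight q`,
      -- against the choice of `q`.
      maximal {z} z-nonsingle ⊆ {x} x∈ = decidable-stable (K.FlatDominates? x) λ x∉ →
        <⇒≱ (subst₂ _<_ (sym (weight-comp z∈M)) (sym (weight-comp q∈M))
               (misses-< ⊆ᵇ (complete x) (dec-false (K.FlatDominates? x) x∉) (dec-true (K′.FlatDominates? x) x∈)))
            (All.lookup (f[argmin]≤f[xs] p candidates) (∈-filter⁺ NonSingle? (complete z) z-nonsingle))
        where
        z∈M : M z
        z∈M = NonSingle.p∈M z-nonsingle
        module K = CoComponent (comp q∈M)
        module K′ = CoComponent (comp z∈M)
        ⊆ᵇ : ∀ {y} → dominators (comp q∈M) y ≡ true → dominators (comp z∈M) y ≡ true
        ⊆ᵇ {y} y∈ = dec-true (K′.FlatDominates? y) (⊆ (does-true (K.FlatDominates? y) y∈))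

    divide-or-co-divide : Divide _~_ _≁_ ⊎ Divide _≁_ _~_
    divide-or-co-divide with omniscience (λ x → omniscience (mixed-nonedge x))
      where
      mixed-nonedge : ∀ x y → ¬ (Mixed x × Mixed y × x ≁ y) ⊎ (Mixed x × Mixed y × x ≁ y)
      mixed-nonedge x y with Mixed? x | Mixed? y | tri x y
      ... | no ¬Mx | _ | _ = inj₁ λ (Mx , _) → ¬Mx Mx
      ... | _ | no ¬My | _ = inj₁ λ (_ , My , _) → ¬My My
      ... | _ | _ | inj₁ refl = inj₁ λ (_ , _ , r) → ≁-irr r
      ... | _ | _ | inj₂ (inj₁ r) = inj₁ λ (_ , _ , r′) → ~∧≁ r r′
      ... | yes Mx | yes My | inj₂ (inj₂ r) = inj₂ (Mx , My , r)
    ... | inj₁ none = inj₁ (divide-if-clique λ Mx My r → none _ _ (Mx , My , r))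
    ... | inj₂ (_ , _ , Mx , My , r) = inj₂ (co-divide-from (nonSingle (Mixed⇒M Mx) (Mixed⇒M My) r))

-- The theorem of Földes and Hammer

record SplitOn {V : Set} (_~_ _≁_ : V → V → Set) (D : V → Set) : Set where
  constructor splitOn
  field
    side   : V → Bool
    clique : ∀ {x y} → D x → D y → side x ≡ true → side y ≡ true → x ≢ y → x ~ y
    stable : ∀ {x y} → D x → D y → side x ≡ false → side y ≡ false → x ≢ y → x ≁ y

module _ (S : Structure) where
  open Structure S
  open Basics S

  -- Read in `swap S` this is the induced 4-cycle `a c b d`, the two edges becoming its diagonals.
  Is2K2 : Vertex → Vertex → Vertex → Vertex → Set
  Is2K2 a b c d = a ~ b × c ~ d × a ≁ c × a ≁ d × b ≁ c × b ≁ d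

  -- Growth starts from one edge; the other is the first edge anticomplete to it. A neighbour `n` of
  -- the current set that misses an anticomplete edge `x ~ y` is added, and the same edge survives
  -- in the new state. When none is left, `Done` is the hypothesis `hits` of `Maximal`.
  2K2-divide : ∀ {a b c d} → Is2K2 a b c d → Divide _~_ _≁_ ⊎ Divide _≁_ _~_
  2K2-divide {u₁} {u₂} {w₁} {w₂} (u₁~u₂ , w₁~w₂ , u₁≁w₁ , u₁≁w₂ , u₂≁w₁ , u₂≁w₂)
    with grow advance (insert u₁ (singleton u₂))
           ( Connected-insert (Connected-singleton u₂) (insert-self u₂ _) u₁~u₂
           , insert-self u₁ _ , insert-⊇ u₁ {singleton u₂} (insert-self u₂ _)
           , w₁ , w₂ , anti u₁≁w₁ u₂≁w₁ , anti u₁≁w₂ u₂≁w₂ , w₁~w₂)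
    where
    anti : ∀ {c} → u₁ ≁ c → u₂ ≁ c → ∀ {x} → insert u₁ (singleton u₂) x ≡ true → c ≁ x
    anti {c} p q {x} x∈ with insert⁻ {u₁} {singleton u₂} x∈
    ... | inj₁ refl = ≁-sym p
    ... | inj₂ x∈′ with singleton⁻ {u₂} x∈′
    ... | refl = ≁-sym q

    State : (Vertex → Bool) → Set₁
    State A = Connected A × A u₁ ≡ true × A u₂ ≡ true × ∃₂ λ x y → Sides.Anti S A x × Sides.Anti S A y × x ~ y

    Done : (Vertex → Bool) → Set
    Done A = ∀ n x y → A n ≡ false → (∃ λ a → A a ≡ true × n ~ a) → Sides.Anti S A x → Sides.Anti S A y → x ~ y → n ~ x ⊎ n ~ y

    advance : ∀ A → State A → Done A ⊎ ∃ λ n → A n ≡ false × State (insert n A)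
    advance A (conn , u₁∈ , u₂∈ , _) with omniscience (λ n → omniscience (λ x → omniscience (λ y → test n x y)))
      where
      open Sides S A
      test : ∀ n x y →
        (A n ≡ false → (∃ λ a → A a ≡ true × n ~ a) → Anti x → Anti y → x ~ y → n ~ x ⊎ n ~ y) ⊎
        (A n ≡ false × (∃ λ a → A a ≡ true × n ~ a) × Anti x × Anti y × x ~ y × n ≁ x × n ≁ y)
      test n x y with tri n x | tri n y | Anti? x | Anti? y | tri x y | Anti? n
      ... | inj₁ refl | _ | _ | _ | _ | _ = inj₁ λ _ (a , a∈ , n~a) anti → ⊥-elim (~∧≁ n~a (anti a∈))
      ... | inj₂ (inj₁ p) | _ | _ | _ | _ | _ = inj₁ λ _ _ _ _ _ → inj₁ p
      ... | _ | inj₁ refl | _ | _ | _ | _ = inj₁ λ _ (a , a∈ , n~a) _ anti → ⊥-elim (~∧≁ n~a (anti a∈))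
      ... | _ | inj₂ (inj₁ p) | _ | _ | _ | _ = inj₁ λ _ _ _ _ _ → inj₂ p
      ... | _ | _ | no ¬x | _ | _ | _ = inj₁ λ _ _ anti → ⊥-elim (¬x anti)
      ... | _ | _ | _ | no ¬y | _ | _ = inj₁ λ _ _ _ anti → ⊥-elim (¬y anti)
      ... | _ | _ | _ | _ | inj₁ refl | _ = inj₁ λ _ _ _ _ p → ⊥-elim (~-irr p)
      ... | _ | _ | _ | _ | inj₂ (inj₂ q) | _ = inj₁ λ _ _ _ _ p → ⊥-elim (~∧≁ p q)
      ... | _ | _ | _ | _ | _ | yes anti = inj₁ λ _ (a , a∈ , n~a) → ⊥-elim (~∧≁ n~a (anti a∈))
      ... | inj₂ (inj₂ n≁x) | inj₂ (inj₂ n≁y) | yes ax | yes ay | inj₂ (inj₁ x~y) | no ¬anti with classify n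
      ... | pA , n∈ = inj₁ λ n∉ → case trans (sym n∈) n∉ of λ ()
      ... | pB , Bn = inj₂ (Complete⇒∉ Bn , (u₁ , u₁∈ , Bn u₁∈) , (λ {a} → ax {a}) , (λ {a} → ay {a}) , x~y , n≁x , n≁y)
      ... | pC , anti , _ = ⊥-elim (¬anti anti)
      ... | pL , n∉ , nbr , _ = inj₂ (n∉ , nbr , (λ {a} → ax {a}) , (λ {a} → ay {a}) , x~y , n≁x , n≁y)
      ... | pT , anti , _ = ⊥-elim (¬anti anti)
    ... | inj₁ done = inj₁ done
    ... | inj₂ (n , x , y , n∉ , (a , a∈ , n~a) , ax , ay , x~y , n≁x , n≁y) =
      inj₂ (n , n∉ , Connected-insert conn a∈ n~a , insert-⊇ n u₁∈ , insert-⊇ n u₂∈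
              , x , y , extend ax n≁x , extend ay n≁y , x~y)
      where
      extend : ∀ {x} → Sides.Anti S A x → n ≁ x → Sides.Anti S (insert n A) x
      extend ax n≁x {z} z∈ with insert⁻ {n} {A} z∈
      ... | inj₁ refl = ≁-sym n≁x
      ... | inj₂ z∈A = ax z∈A
  ... | A , (conn , u₁∈ , u₂∈ , x , y , ax , ay , x~y) , done =
    Maximal.divide-or-co-divide S A conn u₁∈ u₂∈ (~⇒≢ u₁~u₂) (x , ax , y , ay , x~y)
      (λ n∉ nbr ax ay x~y → done _ _ _ n∉ nbr ax ay x~y)

  from-cover : ∀ {D K I : Vertex → Set} → (∀ x → Dec (D x)) → (∀ {x} → D x → K x ⊎ I x) →
    (∀ {x y} → K x → K y → x ≢ y → x ~ y) → (∀ {x y} → I x → I y → x ≢ y → x ≁ y) → SplitOn _~_ _≁_ D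
  from-cover {D} {K} {I} D? cover K-clique I-stable = splitOn side
      (λ Dx Dy p q → K-clique (side-K Dx p) (side-K Dy q))
      (λ Dx Dy p q → I-stable (side-I Dx p) (side-I Dy q))
    where
    side : Vertex → Bool
    side x with D? x
    ... | no _ = true
    ... | yes Dx = [ (λ _ → true) , (λ _ → false) ]′ (cover Dx)
    side-K : ∀ {x} → D x → side x ≡ true → K x
    side-K {x} Dx p with D? x
    ... | no ¬Dx = contradiction Dx ¬Dx
    ... | yes Dx′ with cover Dx′
    ... | inj₁ Kx = Kx
    side-I : ∀ {x} → D x → side x ≡ false → I x
    side-I {x} Dx p with D? x
    ... | yes Dx′ with cover Dx′
    ... | inj₂ Ix = Ix

-- Inserting a vertex into a split partition

module Insertion (S : Structure) where
  open Structure S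
  open Basics S

  module WithNewVertex
    (no-2K2 : ∀ {a b c d} → ¬ Is2K2 S a b c d) (no-C4 : ∀ {a b c d} → ¬ Is2K2 (swap S) a b c d)
    {D : Vertex → Set} (D? : ∀ x → Dec (D x)) {v : Vertex} (v∉D : ¬ D v) (given : SplitOn _~_ _≁_ D) where
    open SplitOn given

    K I D⁺ : Vertex → Set
    K x = D x × side x ≡ true
    I x = D x × side x ≡ false
    D⁺ x = x ≡ v ⊎ D x

    D⁺? : ∀ x → Dec (D⁺ x)
    D⁺? x with x ≟ v | D? x
    ... | yes e | _ = yes (inj₁ e)
    ... | _ | yes Dx = yes (inj₂ Dx)
    ... | no e | no ¬Dx = no [ e , ¬Dx ]′

    K⊎I : ∀ {x} → D x → K x ⊎ I x
    K⊎I {x} Dx with side x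
    ... | true = inj₁ (Dx , refl)
    ... | false = inj₂ (Dx , refl)

    K-clique : ∀ {x y} → K x → K y → x ≢ y → x ~ y
    K-clique (Dx , p) (Dy , q) = clique Dx Dy p q

    I-stable : ∀ {x y} → I x → I y → x ≢ y → x ≁ y
    I-stable (Dx , p) (Dy , q) = stable Dx Dy p q

    K-I-≢ : ∀ {x y} → K x → I y → x ≢ y
    K-I-≢ (_ , p) (_ , q) refl = case trans (sym p) q of λ ()

    v-≢ : ∀ {x} → D x → v ≢ x
    v-≢ Dx refl = v∉D Dx

    all-in : ∀ {X R Q : Vertex → Set} → (∀ x → Dec (X x)) → (∀ {x} → X x → R x ⊎ Q x) →
      (∀ {x} → X x → R x) ⊎ ∃ λ x → X x × Q x
    all-in {X} {R} {Q} X? R⊎Q with omniscience test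
      where
      test : ∀ x → (X x → R x) ⊎ (X x × Q x)
      test x with X? x
      ... | no ¬Xx = inj₁ λ Xx → contradiction Xx ¬Xx
      ... | yes Xx with R⊎Q Xx
      ... | inj₁ r = inj₁ λ _ → r
      ... | inj₂ q = inj₂ (Xx , q)
    ... | inj₁ all = inj₁ λ {x} → all x
    ... | inj₂ found = inj₂ found

    K? : ∀ x → Dec (K x)
    K? x with D? x | side x
    ... | no ¬Dx | _ = no λ (Dx , _) → ¬Dx Dx
    ... | yes Dx | true = yes (Dx , refl)
    ... | yes _ | false = no λ { (_ , ()) }

    I? : ∀ x → Dec (I x)
    I? x with D? x | side x
    ... | no ¬Dx | _ = no λ (Dx , _) → ¬Dx Dx
    ... | yes Dx | false = yes (Dx , refl)
    ... | yes _ | true = no λ { (_ , ()) }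

    adjacent-to-v : ∀ {x} → D x → v ~ x ⊎ v ≁ x
    adjacent-to-v Dx = adjacency (v-≢ Dx)

    -- v enters the clique side or the stable side once i, or a common non-neighbour
    -- m of v and i in K, or both, have changed sides.
    one-neighbour : ∀ {i k} → I i → v ~ i → (∀ {x} → I x → x ≢ i → v ≁ x) → K k → v ≁ k → SplitOn _~_ _≁_ D⁺
    one-neighbour {i} {k} Ii v~i only-i Kk v≁k with all-in K? (λ Kx → adjacency {i} (λ e → K-I-≢ Kx Ii (sym e)))
    ... | inj₁ i-K = from-cover S {K = K′} {I = I′} D⁺? cover K′-clique I′-stable
      where
      K′ I′ : Vertex → Set
      K′ x = x ≡ i ⊎ K x
      I′ x = x ≡ v ⊎ (I x × x ≢ i)
      cover : ∀ {x} → D⁺ x → K′ x ⊎ I′ x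
      cover (inj₁ e) = inj₂ (inj₁ e)
      cover {x} (inj₂ Dx) with x ≟ i | K⊎I Dx
      ... | yes e | _ = inj₁ (inj₁ e)
      ... | no _ | inj₁ Kx = inj₁ (inj₂ Kx)
      ... | no x≢i | inj₂ Ix = inj₂ (inj₂ (Ix , x≢i))
      K′-clique : ∀ {x y} → K′ x → K′ y → x ≢ y → x ~ y
      K′-clique (inj₁ refl) (inj₁ refl) x≢y = contradiction refl x≢y
      K′-clique (inj₁ refl) (inj₂ Ky) _ = i-K Ky
      K′-clique (inj₂ Kx) (inj₁ refl) _ = ~-sym (i-K Kx)
      K′-clique (inj₂ Kx) (inj₂ Ky) = K-clique Kx Ky
      I′-stable : ∀ {x y} → I′ x → I′ y → x ≢ y → x ≁ y
      I′-stable (inj₁ refl) (inj₁ refl) x≢y = contradiction refl x≢y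
      I′-stable (inj₁ refl) (inj₂ (Iy , y≢i)) _ = only-i Iy y≢i
      I′-stable (inj₂ (Ix , x≢i)) (inj₁ refl) _ = ≁-sym (only-i Ix x≢i)
      I′-stable (inj₂ (Ix , _)) (inj₂ (Iy , _)) = I-stable Ix Iy
    ... | inj₂ (m₀ , Km₀ , i≁m₀) = from-m (choose (adjacent-to-v (proj₁ Km₀)))
      where
      i-≢ : ∀ {x} → K x → i ≢ x
      i-≢ Kx e = K-I-≢ Kx Ii (sym e)

      -- If `m₀` is adjacent to `v`, then `k` serves instead: with `i ~ k` there would be the
      -- 4-cycle `v i k m₀`.
      choose : v ~ m₀ ⊎ v ≁ m₀ → ∃ λ m → K m × v ≁ m × i ≁ m
      choose (inj₂ v≁m₀) = m₀ , Km₀ , v≁m₀ , i≁m₀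
      choose (inj₁ v~m₀) with adjacency (i-≢ Kk)
      ... | inj₂ i≁k = k , Kk , v≁k , i≁k
      ... | inj₁ i~k = ⊥-elim (no-C4 (v≁k , i≁m₀ , v~i , v~m₀ , ~-sym i~k
                                     , K-clique Kk Km₀ λ { refl → ~∧≁ v~m₀ v≁k }))

      from-m : (∃ λ m → K m × v ≁ m × i ≁ m) → SplitOn _~_ _≁_ D⁺
      from-m (m , Km , v≁m , i≁m) with all-in {R = λ x → v ≁ x → x ≡ m} K? other
        where
        other : ∀ {x} → K x → (v ≁ x → x ≡ m) ⊎ (v ≁ x × x ≢ m)
        other {x} Kx with x ≟ m | adjacent-to-v (proj₁ Kx)
        ... | yes e | _ = inj₁ λ _ → e
        ... | no _ | inj₁ v~x = inj₁ λ v≁x → ⊥-elim (~∧≁ v~x v≁x)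
        ... | no x≢m | inj₂ v≁x = inj₂ (v≁x , x≢m)
      ... | found = conclude found
        where
        -- A neighbour `x` of `m` in `I` would make `v i` and `m x` two independent edges.
        m-I : ∀ {x} → I x → m ≁ x
        m-I {x} Ix with x ≟ i | adjacency (K-I-≢ Km Ix)
        ... | yes refl | _ = ≁-sym i≁m
        ... | no _ | inj₂ m≁x = m≁x
        ... | no x≢i | inj₁ m~x =
          ⊥-elim (no-2K2 (v~i , m~x , v≁m , only-i Ix x≢i , i≁m , I-stable Ii Ix λ e → x≢i (sym e)))

        -- If `m` is the only non-neighbour of `v` in `K`, the two change places. Otherwise `i`
        -- replaces `m` in the clique, and both `v` and `m` become stable.
        conclude : (∀ {x} → K x → v ≁ x → x ≡ m) ⊎ (∃ λ x → K x × v ≁ x × x ≢ m) → SplitOn _~_ _≁_ D⁺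
        conclude (inj₁ only-m) = from-cover S {K = K′} {I = I′} D⁺? cover K′-clique I′-stable
          where
          K′ I′ : Vertex → Set
          K′ x = x ≡ v ⊎ (K x × x ≢ m)
          I′ x = x ≡ m ⊎ I x
          cover : ∀ {x} → D⁺ x → K′ x ⊎ I′ x
          cover (inj₁ e) = inj₁ (inj₁ e)
          cover {x} (inj₂ Dx) with x ≟ m | K⊎I Dx
          ... | yes e | _ = inj₂ (inj₁ e)
          ... | no x≢m | inj₁ Kx = inj₁ (inj₂ (Kx , x≢m))
          ... | no _ | inj₂ Ix = inj₂ (inj₂ Ix)
          v-K : ∀ {x} → K x → x ≢ m → v ~ x
          v-K Kx x≢m with adjacent-to-v (proj₁ Kx)
          ... | inj₁ p = p
          ... | inj₂ q = contradiction (only-m Kx q) x≢m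
          K′-clique : ∀ {x y} → K′ x → K′ y → x ≢ y → x ~ y
          K′-clique (inj₁ refl) (inj₁ refl) x≢y = contradiction refl x≢y
          K′-clique (inj₁ refl) (inj₂ (Ky , y≢m)) _ = v-K Ky y≢m
          K′-clique (inj₂ (Kx , x≢m)) (inj₁ refl) _ = ~-sym (v-K Kx x≢m)
          K′-clique (inj₂ (Kx , _)) (inj₂ (Ky , _)) = K-clique Kx Ky
          I′-stable : ∀ {x y} → I′ x → I′ y → x ≢ y → x ≁ y
          I′-stable (inj₁ refl) (inj₁ refl) x≢y = contradiction refl x≢y
          I′-stable (inj₁ refl) (inj₂ Iy) _ = m-I Iy
          I′-stable (inj₂ Ix) (inj₁ refl) _ = ≁-sym (m-I Ix)
          I′-stable (inj₂ Ix) (inj₂ Iy) = I-stable Ix Iy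
        conclude (inj₂ (k₂ , Kk₂ , v≁k₂ , k₂≢m)) = from-cover S {K = K′} {I = I′} D⁺? cover K′-clique I′-stable
          where
          i-K′ : ∀ {x} → K x → v ≁ x → x ≢ m → i ~ x
          i-K′ Kx v≁x x≢m with adjacency (i-≢ Kx)
          ... | inj₁ p = p
          ... | inj₂ i≁x = ⊥-elim (no-2K2 (v~i , K-clique Kx Km x≢m , v≁x , v≁m , i≁x , i≁m))
          -- For `v ≁ x`, a missing adjacency leaves the independent edges `v i` and `x m`. For
          -- `v ~ x`, it leaves the 4-cycle `v i k₂ x`.
          i-K : ∀ {x} → K x → x ≢ m → i ~ x
          i-K Kx x≢m with adjacent-to-v (proj₁ Kx) | adjacency (i-≢ Kx)
          ... | _ | inj₁ p = p
          ... | inj₂ v≁x | _ = i-K′ Kx v≁x x≢m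
          ... | inj₁ v~x | inj₂ i≁x = ⊥-elim (no-C4 (v≁k₂ , i≁x , v~i , v~x , ~-sym (i-K′ Kk₂ v≁k₂ k₂≢m)
                                                    , K-clique Kk₂ Kx λ { refl → ~∧≁ v~x v≁k₂ }))
          K′ I′ : Vertex → Set
          K′ x = x ≡ i ⊎ (K x × x ≢ m)
          I′ x = (x ≡ v ⊎ x ≡ m) ⊎ (I x × x ≢ i)
          cover : ∀ {x} → D⁺ x → K′ x ⊎ I′ x
          cover (inj₁ e) = inj₂ (inj₁ (inj₁ e))
          cover {x} (inj₂ Dx) with x ≟ i | x ≟ m | K⊎I Dx
          ... | yes e | _ | _ = inj₁ (inj₁ e)
          ... | _ | yes e | _ = inj₂ (inj₁ (inj₂ e))
          ... | no _ | no x≢m | inj₁ Kx = inj₁ (inj₂ (Kx , x≢m))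
          ... | no x≢i | no _ | inj₂ Ix = inj₂ (inj₂ (Ix , x≢i))
          K′-clique : ∀ {x y} → K′ x → K′ y → x ≢ y → x ~ y
          K′-clique (inj₁ refl) (inj₁ refl) x≢y = contradiction refl x≢y
          K′-clique (inj₁ refl) (inj₂ (Ky , y≢m)) _ = i-K Ky y≢m
          K′-clique (inj₂ (Kx , x≢m)) (inj₁ refl) _ = ~-sym (i-K Kx x≢m)
          K′-clique (inj₂ (Kx , _)) (inj₂ (Ky , _)) = K-clique Kx Ky
          vm-I : ∀ {x y} → x ≡ v ⊎ x ≡ m → I y → y ≢ i → x ≁ y
          vm-I (inj₁ refl) = only-i
          vm-I (inj₂ refl) Iy _ = m-I Iy
          I′-stable : ∀ {x y} → I′ x → I′ y → x ≢ y → x ≁ y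
          I′-stable (inj₁ (inj₁ refl)) (inj₁ (inj₁ refl)) x≢y = contradiction refl x≢y
          I′-stable (inj₁ (inj₁ refl)) (inj₁ (inj₂ refl)) _ = v≁m
          I′-stable (inj₁ (inj₂ refl)) (inj₁ (inj₁ refl)) _ = ≁-sym v≁m
          I′-stable (inj₁ (inj₂ refl)) (inj₁ (inj₂ refl)) x≢y = contradiction refl x≢y
          I′-stable (inj₁ p) (inj₂ (Iy , y≢i)) _ = vm-I p Iy y≢i
          I′-stable (inj₂ (Ix , x≢i)) (inj₁ p) _ = ≁-sym (vm-I p Ix x≢i)
          I′-stable (inj₂ (Ix , _)) (inj₂ (Iy , _)) = I-stable Ix Iy

    extend-K : (∀ {x} → K x → v ~ x) → SplitOn _~_ _≁_ D⁺
    extend-K v-K = from-cover S {K = λ x → x ≡ v ⊎ K x} {I = I} D⁺? cover K′-clique I-stable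
      where
      cover : ∀ {x} → D⁺ x → (x ≡ v ⊎ K x) ⊎ I x
      cover (inj₁ e) = inj₁ (inj₁ e)
      cover (inj₂ Dx) = [ (λ Kx → inj₁ (inj₂ Kx)) , inj₂ ]′ (K⊎I Dx)
      K′-clique : ∀ {x y} → x ≡ v ⊎ K x → y ≡ v ⊎ K y → x ≢ y → x ~ y
      K′-clique (inj₁ refl) (inj₁ refl) x≢y = contradiction refl x≢y
      K′-clique (inj₁ refl) (inj₂ Ky) _ = v-K Ky
      K′-clique (inj₂ Kx) (inj₁ refl) _ = ~-sym (v-K Kx)
      K′-clique (inj₂ Kx) (inj₂ Ky) = K-clique Kx Ky

SplitOn-swap : ∀ {V} {_~_ _≁_ : V → V → Set} {D} → SplitOn _~_ _≁_ D → SplitOn _≁_ _~_ D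
SplitOn-swap (splitOn side clique stable) = splitOn (λ x → not (side x))
  (λ Dx Dy p q → stable Dx Dy (not-true p) (not-true q))
  (λ Dx Dy p q → clique Dx Dy (not-false p) (not-false q))
  where
  not-true : ∀ {b} → not b ≡ true → b ≡ false
  not-true {false} _ = refl
  not-false : ∀ {b} → not b ≡ false → b ≡ true
  not-false {true} _ = refl

module _ (S : Structure) where
  open Structure S
  open Basics S

  module _ (no-2K2 : ∀ {a b c d} → ¬ Is2K2 S a b c d) (no-C4 : ∀ {a b c d} → ¬ Is2K2 (swap S) a b c d) where

    -- The clique side accepts `v` unless `v` has a non-neighbour in it, and the stable side unless
    -- `v` has a neighbour in it. A unique exception on either side is repaired by `one-neighbour`,
    -- in the graph or in the complement; two exceptions on both sides contradict the hypotheses.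
    insert-split : ∀ {D : Vertex → Set} → (∀ x → Dec (D x)) → ∀ {v} → ¬ D v → SplitOn _~_ _≁_ D → SplitOn _~_ _≁_ (λ x → x ≡ v ⊎ D x)
    insert-split {D} D? {v} v∉D given = by-nonneighbours (all-in K? (λ Kx → adjacent-to-v (proj₁ Kx)))
      where
      open Insertion.WithNewVertex S no-2K2 no-C4 D? v∉D given
      module CoInsertion = Insertion.WithNewVertex (swap S) no-C4 no-2K2 D? v∉D (SplitOn-swap given)

      to-co-K : ∀ {x} → I x → CoInsertion.K x
      to-co-K (Dx , p) = Dx , cong not p
      to-co-I : ∀ {x} → K x → CoInsertion.I x
      to-co-I (Dx , p) = Dx , cong not p
      from-co-K : ∀ {x} → CoInsertion.K x → I x
      from-co-K (Dx , p) = Dx , trans (sym (Bool.not-involutive _)) (cong not p)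
      from-co-I : ∀ {x} → CoInsertion.I x → K x
      from-co-I (Dx , p) = Dx , trans (sym (Bool.not-involutive _)) (cong not p)

      unique? : ∀ {X R : Vertex → Set} → (∀ x → Dec (X x)) → (∀ {x} → X x → R x ⊎ ¬ R x) → ∀ i →
        (∀ {x} → X x → x ≢ i → ¬ R x) ⊎ (∃ λ x → X x × x ≢ i × R x)
      unique? X? R? i = all-in X? λ {x} Xx → case x ≟ i of λ
        { (yes e) → inj₁ λ x≢i → contradiction e x≢i
        ; (no x≢i) → [ (λ r → inj₂ (x≢i , r)) , (λ ¬r → inj₁ λ _ → ¬r) ]′ (R? Xx) }

      v~? : ∀ {x} → D x → v ~ x ⊎ ¬ v ~ x
      v~? Dx = [ inj₁ , (λ q → inj₂ λ p → ~∧≁ p q) ]′ (adjacent-to-v Dx)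
      v≁? : ∀ {x} → D x → v ≁ x ⊎ ¬ v ≁ x
      v≁? Dx = [ (λ p → inj₂ λ q → ~∧≁ p q) , inj₁ ]′ (adjacent-to-v Dx)

      -- If `i′ ~ k`, then `v i k i′` is a 4-cycle. Otherwise `i′ ~ k′`, lest `v i′` and `k k′` be
      -- independent; then `i ~ k′` gives the 4-cycle `v i k′ i′`, and `i ≁ k′` the 5-cycle
      -- `v i k k′ i′`.
      pentagon : ∀ {i i′ k k′} → I i → v ~ i → I i′ → i ≢ i′ → v ~ i′ → K k → v ≁ k → K k′ → k ≢ k′ → v ≁ k′ → ¬ i ~ k
      pentagon Ii v~i Ii′ i≢i′ v~i′ Kk v≁k Kk′ k≢k′ v≁k′ i~k
        with adjacency (λ e → K-I-≢ Kk Ii′ (sym e)) | adjacency (λ e → K-I-≢ Kk′ Ii′ (sym e)) | adjacency (λ e → K-I-≢ Kk′ Ii (sym e))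
      ... | inj₁ i′~k | _ | _ = no-C4 (v≁k , I-stable Ii Ii′ i≢i′ , v~i , v~i′ , ~-sym i~k , ~-sym i′~k)
      ... | inj₂ i′≁k | inj₂ i′≁k′ | _ = no-2K2 (v~i′ , K-clique Kk Kk′ k≢k′ , v≁k , v≁k′ , i′≁k , i′≁k′)
      ... | _ | inj₁ i′~k′ | inj₁ i~k′ = no-C4 (v≁k′ , I-stable Ii Ii′ i≢i′ , v~i , v~i′ , ~-sym i~k′ , ~-sym i′~k′)
      ... | inj₂ i′≁k | inj₁ i′~k′ | inj₂ i≁k′ =
        c5 v~i i~k (K-clique Kk Kk′ k≢k′) (~-sym i′~k′) (~-sym v~i′) v≁k v≁k′ i≁k′ (I-stable Ii Ii′ i≢i′) (≁-sym i′≁k)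

      obstruction : ∀ {i i′ k k′} → I i → v ~ i → I i′ → i ≢ i′ → v ~ i′ → K k → v ≁ k → K k′ → k ≢ k′ → v ≁ k′ → ⊥
      obstruction Ii v~i Ii′ i≢i′ v~i′ Kk v≁k Kk′ k≢k′ v≁k′
        with adjacency (λ e → K-I-≢ Kk Ii (sym e)) | adjacency (λ e → K-I-≢ Kk′ Ii (sym e))
      ... | inj₁ i~k | _ = pentagon Ii v~i Ii′ i≢i′ v~i′ Kk v≁k Kk′ k≢k′ v≁k′ i~k
      ... | _ | inj₁ i~k′ = pentagon Ii v~i Ii′ i≢i′ v~i′ Kk′ v≁k′ Kk (λ e → k≢k′ (sym e)) v≁k i~k′
      ... | inj₂ i≁k | inj₂ i≁k′ = no-2K2 (v~i , K-clique Kk Kk′ k≢k′ , v≁k , v≁k′ , i≁k , i≁k′)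

      by-neighbours : ∀ {k} → K k → v ≁ k → (∀ {x} → I x → v ≁ x) ⊎ (∃ λ x → I x × v ~ x) → SplitOn _~_ _≁_ D⁺
      by-neighbours _ _ (inj₁ v-I) = SplitOn-swap (CoInsertion.extend-K λ Kx → v-I (from-co-K Kx))
      by-neighbours {k} Kk v≁k (inj₂ (i , Ii , v~i))
        with unique? I? (λ Ix → v~? (proj₁ Ix)) i | unique? K? (λ Kx → v≁? (proj₁ Kx)) k
      ... | inj₁ only-i | _ = one-neighbour Ii v~i
              (λ Ix x≢i → [ (λ p → contradiction p (only-i Ix x≢i)) , (λ q → q) ]′ (adjacent-to-v (proj₁ Ix))) Kk v≁k
      ... | _ | inj₁ only-k = SplitOn-swap (CoInsertion.one-neighbour (to-co-I Kk) v≁k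
              (λ Ix x≢k → [ (λ p → p) , (λ q → contradiction q (only-k (from-co-I Ix) x≢k)) ]′ (adjacent-to-v (proj₁ Ix))) (to-co-K Ii) v~i)
      ... | inj₂ (i′ , Ii′ , i′≢i , v~i′) | inj₂ (k′ , Kk′ , k′≢k , v≁k′) =
        ⊥-elim (obstruction Ii v~i Ii′ (λ e → i′≢i (sym e)) v~i′ Kk v≁k Kk′ (λ e → k′≢k (sym e)) v≁k′)

      by-nonneighbours : (∀ {x} → K x → v ~ x) ⊎ (∃ λ x → K x × v ≁ x) → SplitOn _~_ _≁_ D⁺
      by-nonneighbours (inj₁ v-K) = extend-K v-K
      by-nonneighbours (inj₂ (k , Kk , v≁k)) =
        by-neighbours Kk v≁k (all-in I? λ Ix → [ inj₂ , inj₁ ]′ (adjacent-to-v (proj₁ Ix)))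

    split-on-list : ∀ xs → SplitOn _~_ _≁_ (_∈ xs)
    split-on-list [] = splitOn (λ _ → true) (λ ()) (λ ())
    split-on-list (v ∷ xs) with split-on-list xs | v ∈? xs
      where open DecMembership _≟_ using (_∈?_)
    ... | splitOn side clique stable | yes v∈xs =
      splitOn side (λ x∈ y∈ → clique (tail x∈) (tail y∈)) (λ x∈ y∈ → stable (tail x∈) (tail y∈))
      where
      tail : ∀ {x} → x ∈ v ∷ xs → x ∈ xs
      tail (here refl) = v∈xs
      tail (there x∈) = x∈
    ... | given | no v∉xs with insert-split (λ x → x ∈? xs) v∉xs given
      where open DecMembership _≟_ using (_∈?_)
    ... | splitOn side clique stable =
      splitOn side (λ x∈ y∈ → clique (uncons x∈) (uncons y∈)) (λ x∈ y∈ → stable (uncons x∈) (uncons y∈))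
      where
      uncons : ∀ {x} → x ∈ v ∷ xs → x ≡ v ⊎ x ∈ xs
      uncons (here e) = inj₁ e
      uncons (there x∈) = inj₂ x∈

IsSplitStructure : Structure → Set
IsSplitStructure S = ∃ λ (side : Vertex → Bool) →
    (∀ {x y} → x ≢ y → side x ≡ true → side y ≡ true → x ~ y) ×
    (∀ {x y} → x ≢ y → side x ≡ false → side y ≡ false → x ≁ y)
  where open Structure S

2K2? : (S : Structure) (let open Structure S) →
  (∀ {a b c d} → ¬ Is2K2 S a b c d) ⊎ (∃₂ λ a b → ∃₂ λ c d → Is2K2 S a b c d)
2K2? S with omniscience (λ a → omniscience (λ b → omniscience (λ c → omniscience (λ d → test a b c d))))
  where
  open Structure S
  open Basics S
  test : ∀ a b c d → ¬ Is2K2 S a b c d ⊎ Is2K2 S a b c d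
  test a b c d with (a ~? b) ×-dec (c ~? d) ×-dec (a ≁? c) ×-dec (a ≁? d) ×-dec (b ≁? c) ×-dec (b ≁? d)
  ... | yes p = inj₂ p
  ... | no ¬p = inj₁ ¬p
... | inj₁ none = inj₁ λ {a} {b} {c} {d} → none a b c d
... | inj₂ (a , b , c , d , p) = inj₂ (a , b , c , d , p)

split-or-divide : (S : Structure) (let open Structure S) →
  IsSplitStructure S ⊎ Divide _~_ _≁_ ⊎ Divide _≁_ _~_
split-or-divide S with 2K2? S | 2K2? (swap S)
... | inj₂ (_ , _ , _ , _ , p) | _ = inj₂ (2K2-divide S p)
... | _ | inj₂ (_ , _ , _ , _ , p) = inj₂ (swap-⊎ (2K2-divide (swap S) p))
... | inj₁ no-2K2 | inj₁ no-C4 with split-on-list S no-2K2 no-C4 elems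
  where open Structure S
... | splitOn side clique stable = inj₁ (side , (λ x≢y p q → clique (complete _) (complete _) p q x≢y)
                                              , (λ x≢y p q → stable (complete _) (complete _) p q x≢y))
  where open Structure S

-- Graphs and the three obstructions

-- Elements of `X` are numbered by their position among the values of `f`, which the partial inverse
-- `g` makes decidable. A single missed value makes the count strictly smaller than `n`.
module Finite {X : Set} {n : ℕ} (f : X → Fin n) (g : Fin n → Maybe X)
  (g∘f : ∀ x → g (f x) ≡ just x) (f∘g : ∀ {i x} → g i ≡ just x → f x ≡ i) where

  hit? : ∀ i → Dec (∃ λ x → g i ≡ just x)
  hit? i with g i
  ... | just x = yes (x , refl)
  ... | nothing = no λ ()

  image : List (Fin n)
  image = filter hit? (allFin n)

  image-unique : Unique image
  image-unique = filter⁺ hit? (allFin⁺ n)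

  ∈-image : ∀ x → f x ∈ image
  ∈-image x = ∈-filter⁺ hit? (∈-allFin (f x)) (x , g∘f x)

  preimage : ∀ i → ∃ λ x → g (lookup image i) ≡ just x
  preimage i = proj₂ (∈-filter⁻ hit? {xs = allFin n} (∈-lookup i))

  index-∈-lookup : ∀ {A : Set} (xs : List A) i → Any.index (∈-lookup {xs = xs} i) ≡ i
  index-∈-lookup (x ∷ xs) zero = refl
  index-∈-lookup (x ∷ xs) (suc i) = cong suc (index-∈-lookup xs i)

  index-irrelevant : ∀ {i j} (e : i ≡ j) (p : i ∈ image) (q : j ∈ image) → Any.index p ≡ Any.index q
  index-irrelevant refl p q = cong Any.index (unique⇒irrelevant image-unique p q)

  X↔Fin : X ↔ Fin (length image)
  X↔Fin = mk↔ₛ′ (λ x → Any.index (∈-image x)) (λ i → proj₁ (preimage i))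
    (λ i → trans (index-irrelevant (f∘g (proj₂ (preimage i))) (∈-image _) (∈-lookup i)) (index-∈-lookup image i))
    (λ x → Maybe.just-injective (trans (sym (proj₂ (preimage (Any.index (∈-image x)))))
             (trans (cong g (sym (lookup-index (∈-image x)))) (g∘f x))))

  image-smaller : ∀ {i} → g i ≡ nothing → length image < n
  image-smaller {i} gi = subst (length image <_) (length-tabulate {n = n} (λ i → i))
    (filter-notAll hit? (allFin n) (lose (∈-allFin i) λ (x , e) → case trans (sym gi) e of λ ()))

data Obstruction : Set where
  path co-path cycle : Obstruction

forbiddenAdj : Obstruction → Fin 5 → Fin 5 → Bool
forbiddenAdj path = p5adj
forbiddenAdj co-path = complAdj P5
forbiddenAdj cycle = c5adj

pattern-sym : ∀ o i j → forbiddenAdj o i j ≡ forbiddenAdj o j i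
pattern-sym path = adj-sym P5
pattern-sym co-path = complAdj-sym P5
pattern-sym cycle = adj-sym C5

pattern-irrefl : ∀ o i → forbiddenAdj o i i ≡ false
pattern-irrefl path = adj-irrefl P5
pattern-irrefl co-path = complAdj-irrefl P5
pattern-irrefl cycle = adj-irrefl C5

pattern-twin-free : ∀ o {i j} → (∀ k → forbiddenAdj o i k ≡ forbiddenAdj o j k) → i ≡ j
pattern-twin-free o {i} {j} = check o i j
  where
  check? : ∀ o → Dec (∀ i j → (∀ k → forbiddenAdj o i k ≡ forbiddenAdj o j k) → i ≡ j)
  check? o = Fin.all? λ i → Fin.all? λ j → (Fin.all? λ k → forbiddenAdj o i k Bool.≟ forbiddenAdj o j k) →-dec (i Fin.≟ j)
  check : ∀ o i j → (∀ k → forbiddenAdj o i k ≡ forbiddenAdj o j k) → i ≡ j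
  check path = from-yes (check? path)
  check co-path = from-yes (check? co-path)
  check cycle = from-yes (check? cycle)

-- Injectivity is left out because `pattern-twin-free` supplies it: vertices with the same image
-- would have the same neighbours.
Embeds : {W : Set} → (W → W → Bool) → Obstruction → Set
Embeds {W} r o = Σ[ f ∈ (Fin 5 → W) ] (∀ i j → r (f i) (f j) ≡ forbiddenAdj o i j)

Embeds-map : ∀ {W W′ : Set} {r : W → W → Bool} {r′ : W′ → W′ → Bool} {o} (h : W → W′) →
  (∀ x y → r′ (h x) (h y) ≡ r x y) → Embeds r o → Embeds r′ o
Embeds-map h h-adj (f , f-adj) = (λ i → h (f i)) , λ i j → trans (h-adj _ _) (f-adj i j)

Embeds-injective : ∀ {W : Set} {r : W → W → Bool} o (e : Embeds r o) → ∀ {i j} → proj₁ e i ≡ proj₁ e j → i ≡ j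
Embeds-injective {r = r} o (f , f-adj) {i} {j} e = pattern-twin-free o λ k →
  trans (sym (f-adj i k)) (trans (cong (λ x → r x (f k)) e) (f-adj j k))

Free⇒¬Embeds : ∀ G → Free G → ∀ o → ¬ Embeds (adj G) o
Free⇒¬Embeds G (no-path , no-co-path , no-cycle) = λ where
  path e@(f , p) → no-path (f , Embeds-injective {r = adj G} path e , p)
  co-path e@(f , p) → no-co-path (f , Embeds-injective {r = adj G} co-path e , p)
  cycle e@(f , p) → no-cycle (f , Embeds-injective {r = adj G} cycle e , p)

¬Embeds⇒Free : ∀ G → (∀ o → ¬ Embeds (adj G) o) → Free G
¬Embeds⇒Free G none = (λ (f , _ , p) → none path (f , p)) , (λ (f , _ , p) → none co-path (f , p)) , (λ (f , _ , p) → none cycle (f , p))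

module _ (G : Graph) where

  Adjacent NonAdjacent : V G → V G → Set
  Adjacent x y = adj G x y ≡ true
  NonAdjacent x y = x ≢ y × adj G x y ≡ false

  five : V G → V G → V G → V G → V G → Fin 5 → V G
  five a b c d e 0F = a
  five a b c d e 1F = b
  five a b c d e 2F = c
  five a b c d e 3F = d
  five a b c d e 4F = e

  embeds-five : ∀ o {a b c d e} → let r = adj G ; p = forbiddenAdj o in
    r a b ≡ p 0F 1F → r b c ≡ p 1F 2F → r c d ≡ p 2F 3F → r d e ≡ p 3F 4F → r e a ≡ p 4F 0F →
    r a c ≡ p 0F 2F → r a d ≡ p 0F 3F → r b d ≡ p 1F 3F → r b e ≡ p 1F 4F → r c e ≡ p 2F 4F → Embeds (adj G) o
  embeds-five o {a} {b} {c} {d} {e} ab bc cd de ea ac ad bd be ce = f , on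
    where
    f : Fin 5 → V G
    f = five a b c d e
    flip : ∀ i j → adj G (f i) (f j) ≡ forbiddenAdj o i j → adj G (f j) (f i) ≡ forbiddenAdj o j i
    flip i j p = trans (adj-sym G (f j) (f i)) (trans p (pattern-sym o i j))
    diagonal : ∀ i → adj G (f i) (f i) ≡ forbiddenAdj o i i
    diagonal i = trans (adj-irrefl G (f i)) (sym (pattern-irrefl o i))
    on : ∀ i j → adj G (f i) (f j) ≡ forbiddenAdj o i j
    on 0F 0F = diagonal 0F
    on 0F 1F = ab
    on 0F 2F = ac
    on 0F 3F = ad
    on 0F 4F = flip 4F 0F ea
    on 1F 0F = flip 0F 1F ab
    on 1F 1F = diagonal 1F
    on 1F 2F = bc
    on 1F 3F = bd
    on 1F 4F = be
    on 2F 0F = flip 0F 2F ac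
    on 2F 1F = flip 1F 2F bc
    on 2F 2F = diagonal 2F
    on 2F 3F = cd
    on 2F 4F = ce
    on 3F 0F = flip 0F 3F ad
    on 3F 1F = flip 1F 3F bd
    on 3F 2F = flip 2F 3F cd
    on 3F 3F = diagonal 3F
    on 3F 4F = de
    on 4F 0F = ea
    on 4F 1F = flip 1F 4F be
    on 4F 2F = flip 2F 4F ce
    on 4F 3F = flip 3F 4F de
    on 4F 4F = diagonal 4F

  NonAdjacent-sym : ∀ {x y} → NonAdjacent x y → NonAdjacent y x
  NonAdjacent-sym (x≢y , q) = (λ e → x≢y (sym e)) , trans (adj-sym G _ _) q

  trichotomy : ∀ x y → x ≡ y ⊎ Adjacent x y ⊎ NonAdjacent x y
  trichotomy x y with _≟V_ G x y | adj G x y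
  ... | yes e | _ = inj₁ e
  ... | no _ | true = inj₂ (inj₁ refl)
  ... | no x≢y | false = inj₂ (inj₂ (x≢y , refl))

  structure : Free G → Structure
  structure free = record
    { Vertex = V G
    ; elems = map from (allFin (size G))
    ; complete = λ v → subst (_∈ map from (allFin (size G))) (inverseʳ refl) (∈-map⁺ from (∈-allFin (to v)))
    ; _~_ = Adjacent ; _≁_ = NonAdjacent
    ; ~-sym = λ p → trans (adj-sym G _ _) p
    ; ≁-sym = NonAdjacent-sym
    ; tri = trichotomy
    ; ~-irr = λ p → case trans (sym (adj-irrefl G _)) p of λ ()
    ; ≁-irr = λ (x≢x , _) → x≢x refl
    ; ~∧≁ = λ p (_ , q) → case trans (sym p) q of λ ()
    ; p5 = λ ab bc cd de (_ , ac) (_ , ad) (_ , ae) (_ , bd) (_ , be) (_ , ce) →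
        none path (embeds-five path ab bc cd de (trans (adj-sym G _ _) ae) ac ad bd be ce)
    ; co-p5 = λ (_ , ab) (_ , bc) (_ , cd) (_ , de) ac ad ae bd be ce →
        none co-path (embeds-five co-path ab bc cd de (trans (adj-sym G _ _) ae) ac ad bd be ce)
    ; c5 = λ ab bc cd de ea (_ , ac) (_ , ad) (_ , bd) (_ , be) (_ , ce) →
        none cycle (embeds-five cycle ab bc cd de ea ac ad bd be ce)
    }
    where
    open Inverse (enum G)
    none : ∀ o → ¬ Embeds (adj G) o
    none = Free⇒¬Embeds G free

  compl-Adjacent : ∀ {x y} → NonAdjacent x y → complAdj G x y ≡ true
  compl-Adjacent {x} {y} (x≢y , q) with _≟V_ G x y
  ... | yes e = contradiction e x≢y
  ... | no _ = cong not q

  compl-Adjacent⁻ : ∀ {x y} → complAdj G x y ≡ true → NonAdjacent x y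
  compl-Adjacent⁻ {x} {y} p with _≟V_ G x y
  ... | no x≢y = x≢y , trans (sym (Bool.not-involutive _)) (cong not p)

  compl-NonAdjacent : ∀ {x y} → Adjacent x y → x ≢ y × complAdj G x y ≡ false
  compl-NonAdjacent {x} {y} p with _≟V_ G x y
  ... | yes refl = case trans (sym (adj-irrefl G _)) p of λ ()
  ... | no x≢y = x≢y , cong not p

  compl-NonAdjacent⁻ : ∀ {x y} → x ≢ y × complAdj G x y ≡ false → Adjacent x y
  compl-NonAdjacent⁻ {x} {y} (x≢y , q) with _≟V_ G x y
  ... | yes e = contradiction e x≢y
  ... | no _ = trans (sym (Bool.not-involutive _)) (cong not q)

-- x ↦ 2x (mod 5) turns the 5-cycle into its complement.
co-cycle-map : Fin 5 → Fin 5
co-cycle-map 0F = 0F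
co-cycle-map 1F = 2F
co-cycle-map 2F = 4F
co-cycle-map 3F = 1F
co-cycle-map 4F = 3F

co-obstruction : Obstruction → Obstruction
co-obstruction path = co-path
co-obstruction co-path = path
co-obstruction cycle = cycle

co-pattern-map : Obstruction → Fin 5 → Fin 5
co-pattern-map cycle = co-cycle-map
co-pattern-map path i = i
co-pattern-map co-path i = i

-- The two clauses follow the branches of `complAdj`: equal vertices, where the value is `false`,
-- and distinct ones, where the adjacency is negated.
CoPattern : Obstruction → Set
CoPattern o = ∀ i j → let σ = co-pattern-map (co-obstruction o) in
  (σ i ≡ σ j → false ≡ forbiddenAdj (co-obstruction o) i j) ×
  (σ i ≢ σ j → not (forbiddenAdj o (σ i) (σ j)) ≡ forbiddenAdj (co-obstruction o) i j)

co-pattern : ∀ o → CoPattern o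
co-pattern = λ where
    path → from-yes (check? path)
    co-path → from-yes (check? co-path)
    cycle → from-yes (check? cycle)
  where
  check? : ∀ o → Dec (CoPattern o)
  check? o = Fin.all? λ i → Fin.all? λ j →
    (σ i Fin.≟ σ j →-dec false Bool.≟ forbiddenAdj (co-obstruction o) i j) ×-dec
    (¬? (σ i Fin.≟ σ j) →-dec not (forbiddenAdj o (σ i) (σ j)) Bool.≟ forbiddenAdj (co-obstruction o) i j)
    where
    σ : Fin 5 → Fin 5
    σ = co-pattern-map (co-obstruction o)

Embeds-compl : ∀ G {o} → Embeds (adj G) o → Embeds (complAdj G) (co-obstruction o)
Embeds-compl G {o} e@(f , f-adj) = (λ i → f (σ i)) , on
  where
  σ : Fin 5 → Fin 5
  σ = co-pattern-map (co-obstruction o)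
  on : ∀ i j → complAdj G (f (σ i)) (f (σ j)) ≡ forbiddenAdj (co-obstruction o) i j
  on i j with _≟V_ G (f (σ i)) (f (σ j))
  ... | yes q = proj₁ (co-pattern o i j) (Embeds-injective {r = adj G} o e q)
  ... | no ¬q = trans (cong not (f-adj (σ i) (σ j))) (proj₂ (co-pattern o i j) λ q → ¬q (cong f q))

Free-compl⁻ : ∀ G → Free (compl G) → Free G
Free-compl⁻ G free = ¬Embeds⇒Free G λ o e → Free⇒¬Embeds (compl G) free (co-obstruction o) (Embeds-compl G {o} e)

-- From a divide to a split unification

partial-↔ : ∀ (G : Graph) {X : Set} (ι : X → V G) (κ : V G → Maybe X) →
  (∀ x → κ (ι x) ≡ just x) → (∀ {v x} → κ v ≡ just x → ι x ≡ v) → ∀ {w} → κ w ≡ nothing →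
  ∃ λ k → k < size G × (X ↔ Fin k)
partial-↔ G ι κ κ∘ι ι∘κ {w} κw = _ , F.image-smaller {to w} (trans (cong κ (inverseʳ refl)) κw) , F.X↔Fin
  where
  open Inverse (enum G)
  to-κ : ∀ {i x} → κ (from i) ≡ just x → to (ι x) ≡ i
  to-κ e = trans (cong to (ι∘κ e)) (inverseˡ refl)
  module F = Finite (λ x → to (ι x)) (λ i → κ (from i)) (λ x → trans (cong κ (inverseʳ refl)) (κ∘ι x)) to-κ

induced : ∀ (G : Graph) {X : Set} {k} → X ↔ Fin k → (X → V G) → Graph
induced G {X} e ι = record
  { V = X ; size = _ ; enum = e ; adj = λ x y → adj G (ι x) (ι y)
  ; adj-sym = λ x y → adj-sym G (ι x) (ι y) ; adj-irrefl = λ x → adj-irrefl G (ι x) }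

induced-Free : ∀ (G : Graph) {X : Set} {k} (e : X ↔ Fin k) (ι : X → V G) → Free G → Free (induced G e ι)
induced-Free G e ι free = ¬Embeds⇒Free (induced G e ι) λ o emb →
  Free⇒¬Embeds G free o (Embeds-map {r′ = adj G} {o = o} ι (λ _ _ → refl) emb)

module FromDivide (G : Graph) (free : Free G) (D : Divide (Adjacent G) (NonAdjacent G)) where
  open Divide D

  Side : Part → Set
  Side p = Σ[ v ∈ V G ] In p v

  A B C L T : Set
  A = Side pA
  B = Side pB
  C = Side pC
  L = Side pL
  T = Side pT

  Side-≡ : ∀ {p} {x y : Side p} → proj₁ x ≡ proj₁ y → x ≡ y
  Side-≡ {x = x , e} {.x , e′} refl = cong (x ,_) (≡-irrelevant e e′)

  ι : Vᵤ A B C L T → V G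
  ι (aᵤ x) = proj₁ x
  ι (bᵤ x) = proj₁ x
  ι (cᵤ x) = proj₁ x
  ι (lᵤ x) = proj₁ x
  ι (tᵤ x) = proj₁ x

  place : ∀ v p → In p v → Vᵤ A B C L T
  place v pA e = aᵤ (v , e)
  place v pB e = bᵤ (v , e)
  place v pC e = cᵤ (v , e)
  place v pL e = lᵤ (v , e)
  place v pT e = tᵤ (v , e)

  ι-place : ∀ v p e → ι (place v p e) ≡ v
  ι-place v pA e = refl
  ι-place v pB e = refl
  ι-place v pC e = refl
  ι-place v pL e = refl
  ι-place v pT e = refl

  -- The placement functions take the part and its proof as separate arguments so that this
  -- rewriting is an induction on the equation `part v ≡ p`.
  at-part : ∀ {X : Set} (f : ∀ v p → In p v → X) {v p} (e : In p v) → f v (part v) refl ≡ f v p e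
  at-part f refl = refl

  place-ι : ∀ u → place (ι u) (part (ι u)) refl ≡ u
  place-ι (aᵤ (v , e)) = at-part place e
  place-ι (bᵤ (v , e)) = at-part place e
  place-ι (cᵤ (v , e)) = at-part place e
  place-ι (lᵤ (v , e)) = at-part place e
  place-ι (tᵤ (v , e)) = at-part place e

  G↔Vᵤ : V G ↔ Vᵤ A B C L T
  G↔Vᵤ = mk↔ₛ′ (λ v → place v (part v) refl) ι place-ι (λ v → ι-place v (part v) refl)

  -- Representing `c*` by the vertex `c` of `C` complete to `B` makes the first factor an induced
  -- subgraph of `G`, which therefore inherits freeness; `c′` is left out of it.
  ι₁ : V₁ A B L T → V G
  ι₁ (a₁ x) = proj₁ x
  ι₁ (b₁ x) = proj₁ x
  ι₁ (l₁ x) = proj₁ x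
  ι₁ (t₁ x) = proj₁ x
  ι₁ c* = c

  place₁ : ∀ v p → In p v → Maybe (V₁ A B L T)
  place₁ v pA e = just (a₁ (v , e))
  place₁ v pB e = just (b₁ (v , e))
  place₁ v pL e = just (l₁ (v , e))
  place₁ v pT e = just (t₁ (v , e))
  place₁ v pC e with _≟V_ G v c
  ... | yes _ = just c*
  ... | no _ = nothing

  κ₁ : V G → Maybe (V₁ A B L T)
  κ₁ v = place₁ v (part v) refl

  κ₁-ι₁ : ∀ x → κ₁ (ι₁ x) ≡ just x
  κ₁-ι₁ (a₁ (v , e)) = at-part place₁ e
  κ₁-ι₁ (b₁ (v , e)) = at-part place₁ e
  κ₁-ι₁ (l₁ (v , e)) = at-part place₁ e
  κ₁-ι₁ (t₁ (v , e)) = at-part place₁ e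
  κ₁-ι₁ c* = trans (at-part place₁ c∈C) at-c
    where
    at-c : place₁ c pC c∈C ≡ just c*
    at-c with _≟V_ G c c
    ... | yes _ = refl
    ... | no ¬e = contradiction refl ¬e

  ι₁-κ₁ : ∀ {v x} → κ₁ v ≡ just x → ι₁ x ≡ v
  ι₁-κ₁ {v} = at (part v) refl
    where
    at : ∀ p e {x} → place₁ v p e ≡ just x → ι₁ x ≡ v
    at pA e refl = refl
    at pB e refl = refl
    at pL e refl = refl
    at pT e refl = refl
    at pC e q with _≟V_ G v c | q
    ... | yes v≡c | refl = sym v≡c

  κ₁-c′ : κ₁ c′ ≡ nothing
  κ₁-c′ = trans (at-part place₁ c′∈C) at-c′
    where
    at-c′ : place₁ c′ pC c′∈C ≡ nothing
    at-c′ with _≟V_ G c′ c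
    ... | yes e = contradiction e c′≢c
    ... | no _ = refl

  ι₂ : V₂ B C L T → V G
  ι₂ (b₂ x) = proj₁ x
  ι₂ (c₂ x) = proj₁ x
  ι₂ (l₂ x) = proj₁ x
  ι₂ (t₂ x) = proj₁ x
  ι₂ a* = a

  place₂ : ∀ v p → In p v → Maybe (V₂ B C L T)
  place₂ v pB e = just (b₂ (v , e))
  place₂ v pC e = just (c₂ (v , e))
  place₂ v pL e = just (l₂ (v , e))
  place₂ v pT e = just (t₂ (v , e))
  place₂ v pA e with _≟V_ G v a
  ... | yes _ = just a*
  ... | no _ = nothing

  κ₂ : V G → Maybe (V₂ B C L T)
  κ₂ v = place₂ v (part v) refl

  κ₂-ι₂ : ∀ x → κ₂ (ι₂ x) ≡ just x
  κ₂-ι₂ (b₂ (v , e)) = at-part place₂ e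
  κ₂-ι₂ (c₂ (v , e)) = at-part place₂ e
  κ₂-ι₂ (l₂ (v , e)) = at-part place₂ e
  κ₂-ι₂ (t₂ (v , e)) = at-part place₂ e
  κ₂-ι₂ a* = trans (at-part place₂ a∈A) at-a
    where
    at-a : place₂ a pA a∈A ≡ just a*
    at-a with _≟V_ G a a
    ... | yes _ = refl
    ... | no ¬e = contradiction refl ¬e

  ι₂-κ₂ : ∀ {v x} → κ₂ v ≡ just x → ι₂ x ≡ v
  ι₂-κ₂ {v} = at (part v) refl
    where
    at : ∀ p e {x} → place₂ v p e ≡ just x → ι₂ x ≡ v
    at pB e refl = refl
    at pC e refl = refl
    at pL e refl = refl
    at pT e refl = refl
    at pA e q with _≟V_ G v a | q
    ... | yes v≡a | refl = sym v≡a

  κ₂-a′ : κ₂ a′ ≡ nothing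
  κ₂-a′ = trans (at-part place₂ a′∈A) at-a′
    where
    at-a′ : place₂ a′ pA a′∈A ≡ nothing
    at-a′ with _≟V_ G a′ a
    ... | yes e = contradiction e a′≢a
    ... | no _ = refl

  finite₁ : ∃ λ k → k < size G × (V₁ A B L T ↔ Fin k)
  finite₁ = partial-↔ G ι₁ κ₁ κ₁-ι₁ ι₁-κ₁ κ₁-c′

  finite₂ : ∃ λ k → k < size G × (V₂ B C L T ↔ Fin k)
  finite₂ = partial-↔ G ι₂ κ₂ κ₂-ι₂ ι₂-κ₂ κ₂-a′

  G₁ G₂ : Graph
  G₁ = induced G (proj₂ (proj₂ finite₁)) ι₁
  G₂ = induced G (proj₂ (proj₂ finite₂)) ι₂

  flip : ∀ {x y b} → adj G x y ≡ b → adj G y x ≡ b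
  flip p = trans (adj-sym G _ _) p

  unmixed : ∀ {x} → In pC x → ∀ {b b′ : B} → SameAnticomp (λ x y → adj G (proj₁ x) (proj₁ y)) b b′ →
    adj G x (proj₁ b) ≡ adj G x (proj₁ b′)
  unmixed x∈C (here _) = refl
  unmixed {x} x∈C {b} (step {b' = b′} b≢b′ q rest) = trans one (unmixed x∈C rest)
    where
    nonadjacent : NonAdjacent G (proj₁ b) (proj₁ b′)
    nonadjacent = (λ e → b≢b′ (Side-≡ e)) , q
    one : adj G x (proj₁ b) ≡ adj G x (proj₁ b′)
    one with adj G x (proj₁ b) in e | adj G x (proj₁ b′) in e′
    ... | true | true = refl
    ... | false | false = refl
    ... | true | false = trans (sym (C-unmixed x∈C (proj₂ b) (proj₂ b′) nonadjacent e)) e′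
    ... | false | true = trans (sym e) (C-unmixed x∈C (proj₂ b′) (proj₂ b) (NonAdjacent-sym G nonadjacent) e′)

  composable : Composable A B C L T G₁ G₂ (↔-id _) (↔-id _)
  composable = record
    { A-nonempty = a , a∈A
    ; C-nonempty = c , c∈C
    ; L-clique₁ = λ x y x≢y → L-L (proj₂ x) (proj₂ y) (λ e → x≢y (Side-≡ e))
    ; T-stable₁ = stable
    ; A-B-complete = λ x y → A-B (proj₂ x) (proj₂ y)
    ; A-T-anticomplete = λ x y → proj₂ (A-T (proj₂ x) (proj₂ y))
    ; A-vertex-complete-L = (a , a∈A) , λ l → a-L (proj₂ l)
    ; c*-B-complete = λ b → c-B (proj₂ b)
    ; c*-L-complete = λ l → flip (L-C (proj₂ l) c∈C)
    ; c*-A-anticomplete = λ x → flip (proj₂ (A-C (proj₂ x) c∈C))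
    ; c*-T-anticomplete = λ t → proj₂ (C-T c∈C (proj₂ t))
    ; same-on-BLT = same
    ; T-C-anticomplete = λ t x → flip (proj₂ (C-T (proj₂ x) (proj₂ t)))
    ; L-B-complete = λ l b → L-B (proj₂ l) (proj₂ b)
    ; L-C-complete = λ l x → L-C (proj₂ l) (proj₂ x)
    ; a*-B-complete = λ b → A-B a∈A (proj₂ b)
    ; a*-L-complete = λ l → a-L (proj₂ l)
    ; a*-C-anticomplete = λ x → proj₂ (A-C a∈A (proj₂ x))
    ; a*-T-anticomplete = λ t → proj₂ (A-T a∈A (proj₂ t))
    ; C-vertex-complete-B = (c , c∈C) , λ b → c-B (proj₂ b)
    ; C-not-mixed = λ x b b′ same → unmixed (proj₂ x) same
    }
    where
    stable : ∀ x y → adj G (proj₁ x) (proj₁ y) ≡ false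
    stable (x , x∈T) (y , y∈T) with _≟V_ G x y
    ... | yes refl = adj-irrefl G x
    ... | no x≢y = proj₂ (T-T x∈T y∈T x≢y)
    same : ∀ u v → adj G (ι₂ (emb₂ {A} {B} {C} u)) (ι₂ (emb₂ {A} v)) ≡ adj G (ι₁ (emb₁ {A} {B} {C} u)) (ι₁ (emb₁ {A} {B} {C} v))
    same (b₀ _) (b₀ _) = refl
    same (b₀ _) (l₀ _) = refl
    same (b₀ _) (t₀ _) = refl
    same (l₀ _) (b₀ _) = refl
    same (l₀ _) (l₀ _) = refl
    same (l₀ _) (t₀ _) = refl
    same (t₀ _) (b₀ _) = refl
    same (t₀ _) (l₀ _) = refl
    same (t₀ _) (t₀ _) = refl

  -- Only pairs from `A` and `C` need an argument: there `unifAdj` falls back on `false`, while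
  -- every other value is read off an induced subgraph.
  unifAdj-ι : ∀ u v → unifAdj (adj G₁) (adj G₂) u v ≡ adj G (ι u) (ι v)
  unifAdj-ι (aᵤ _) (aᵤ _) = refl
  unifAdj-ι (aᵤ _) (bᵤ _) = refl
  unifAdj-ι (aᵤ x) (cᵤ y) = sym (proj₂ (A-C (proj₂ x) (proj₂ y)))
  unifAdj-ι (aᵤ _) (lᵤ _) = refl
  unifAdj-ι (aᵤ _) (tᵤ _) = refl
  unifAdj-ι (bᵤ _) (aᵤ _) = refl
  unifAdj-ι (bᵤ _) (bᵤ _) = refl
  unifAdj-ι (bᵤ _) (cᵤ _) = refl
  unifAdj-ι (bᵤ _) (lᵤ _) = refl
  unifAdj-ι (bᵤ _) (tᵤ _) = refl
  unifAdj-ι (cᵤ x) (aᵤ y) = sym (flip (proj₂ (A-C (proj₂ y) (proj₂ x))))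
  unifAdj-ι (cᵤ _) (bᵤ _) = refl
  unifAdj-ι (cᵤ _) (cᵤ _) = refl
  unifAdj-ι (cᵤ _) (lᵤ _) = refl
  unifAdj-ι (cᵤ _) (tᵤ _) = refl
  unifAdj-ι (lᵤ _) (aᵤ _) = refl
  unifAdj-ι (lᵤ _) (bᵤ _) = refl
  unifAdj-ι (lᵤ _) (cᵤ _) = refl
  unifAdj-ι (lᵤ _) (lᵤ _) = refl
  unifAdj-ι (lᵤ _) (tᵤ _) = refl
  unifAdj-ι (tᵤ _) (aᵤ _) = refl
  unifAdj-ι (tᵤ _) (bᵤ _) = refl
  unifAdj-ι (tᵤ _) (cᵤ _) = refl
  unifAdj-ι (tᵤ _) (lᵤ _) = refl
  unifAdj-ι (tᵤ _) (tᵤ _) = refl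

  obtained : ObtainedBySplitUnification G
  obtained = A , B , C , L , T , G₁ , G₂ , ↔-id _ , ↔-id _ , composable
    , induced-Free G (proj₂ (proj₂ finite₁)) ι₁ free , induced-Free G (proj₂ (proj₂ finite₂)) ι₂ free
    , proj₁ (proj₂ finite₁) , proj₁ (proj₂ finite₂)
    , G↔Vᵤ , λ x y → trans (unifAdj-ι (place x (part x) refl) (place y (part y) refl))
                           (cong₂ (adj G) (ι-place x (part x) refl) (ι-place y (part y) refl))

-- The operations preserve freeness

Exhaustible : Set → Set₁
Exhaustible K = ∀ {P : K → Set} → (∀ k → Dec (P k)) → Dec (∀ k → P k)

exhaust-Bool : Exhaustible Bool
exhaust-Bool P? = map′ (λ (t , f) → λ { true → t ; false → f }) (λ p → p true , p false) (P? true ×-dec P? false)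

exhaust-Part : Exhaustible Part
exhaust-Part P? = map′ (λ (a , b , c , l , t) → λ { pA → a ; pB → b ; pC → c ; pL → l ; pT → t })
  (λ p → p pA , p pB , p pC , p pL , p pT) (P? pA ×-dec P? pB ×-dec P? pC ×-dec P? pL ×-dec P? pT)

-- Colourings are enumerated as vectors, since a predicate on functions need not respect pointwise
-- equality; `lookup∘tabulate` translates back.
exhaust-Vec : ∀ {K} → Exhaustible K → ∀ n → Exhaustible (Vec K n)
exhaust-Vec all? zero P? = map′ (λ { p [] → p }) (λ p → p []) (P? [])
exhaust-Vec all? (suc n) P? = map′ (λ { p (k ∷ ks) → p k ks }) (λ p k ks → p (k ∷ ks))
  (all? λ k → exhaust-Vec all? n λ ks → P? (k ∷ ks))

_≟P_ : DecidableEquality Part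
pA ≟P pA = yes refl
pA ≟P pB = no λ ()
pA ≟P pC = no λ ()
pA ≟P pL = no λ ()
pA ≟P pT = no λ ()
pB ≟P pA = no λ ()
pB ≟P pB = yes refl
pB ≟P pC = no λ ()
pB ≟P pL = no λ ()
pB ≟P pT = no λ ()
pC ≟P pA = no λ ()
pC ≟P pB = no λ ()
pC ≟P pC = yes refl
pC ≟P pL = no λ ()
pC ≟P pT = no λ ()
pL ≟P pA = no λ ()
pL ≟P pB = no λ ()
pL ≟P pC = no λ ()
pL ≟P pL = yes refl
pL ≟P pT = no λ ()
pT ≟P pA = no λ ()
pT ≟P pB = no λ ()
pT ≟P pC = no λ ()
pT ≟P pL = no λ ()
pT ≟P pT = yes refl

module _ {K : Set} (o : Obstruction) (col : Fin 5 → K) where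

  Violates : (K → K → Maybe Bool) → Set
  Violates required = ∃₂ λ i j → i ≢ j × required (col i) (col j) ≡ just (not (forbiddenAdj o i j))

  Violates? : ∀ required → Dec (Violates required)
  Violates? required = Fin.any? λ i → Fin.any? λ j → ¬? (i Fin.≟ j) ×-dec
    Maybe.≡-dec Bool._≟_ (required (col i) (col j)) (just (not (forbiddenAdj o i j)))

split-required : Bool → Bool → Maybe Bool
split-required true true = just true
split-required false false = just false
split-required _ _ = nothing

no-split : ∀ o (v : Vec Bool 5) → Violates o (Vec.lookup v) split-required
no-split = λ { path → from-yes (check? path) ; co-path → from-yes (check? co-path) ; cycle → from-yes (check? cycle) }
  where
  check? : ∀ o → Dec (∀ v → Violates o (Vec.lookup v) split-required)
  check? o = exhaust-Vec exhaust-Bool 5 λ v → Violates? o (Vec.lookup v) split-required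

not-self : ∀ {b} → ¬ b ≡ not b
not-self {true} ()
not-self {false} ()

IsSplit⇒Free : ∀ G → IsSplit G → Free G
IsSplit⇒Free G (K , clique , stable) = ¬Embeds⇒Free G λ o e@(f , f-adj) → refute o e (no-split o (tabulate λ i → K (f i)))
  where
  sound : ∀ x y {b} → x ≢ y → split-required (K x) (K y) ≡ just b → adj G x y ≡ b
  sound x y x≢y e with K x in p | K y in q | e
  ... | true | true | refl = clique x y x≢y p q
  ... | false | false | refl = stable x y p q
  refute : ∀ o ((f , _) : Embeds (adj G) o) → ¬ Violates o (Vec.lookup (tabulate λ i → K (f i))) split-required
  refute o e@(f , f-adj) (i , j , i≢j , req) = not-self (trans (sym (f-adj i j))
    (sound (f i) (f j) (λ p → i≢j (Embeds-injective {r = adj G} o e p))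
      (trans (cong₂ split-required (sym (lookup∘tabulate (λ i → K (f i)) i)) (sym (lookup∘tabulate (λ i → K (f i)) j))) req)))

-- Substitution

module _ (o : Obstruction) (col : Fin 5 → Bool) where

  Separated AtMostOne AllInside : Set
  Separated = ∃ λ i → ∃₂ λ j k → col i ≡ true × col j ≡ true × col k ≡ false × forbiddenAdj o i k ≢ forbiddenAdj o j k
  AtMostOne = ∀ i j → col i ≡ true → col j ≡ true → i ≡ j
  AllInside = ∀ i → col i ≡ true

-- The colour marks the vertices lying in the substituted graph. They have the same neighbours
-- outside it, which excludes `Separated`; the other two cases send the obstruction into `G₀`, by
-- contraction to `x`, or into `H`.
obstruction-prime : ∀ o (v : Vec Bool 5) → Separated o (Vec.lookup v) ⊎ AtMostOne o (Vec.lookup v) ⊎ AllInside o (Vec.lookup v)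
obstruction-prime = λ { path → from-yes (check? path) ; co-path → from-yes (check? co-path) ; cycle → from-yes (check? cycle) }
  where
  check? : ∀ o → Dec (∀ v → Separated o (Vec.lookup v) ⊎ AtMostOne o (Vec.lookup v) ⊎ AllInside o (Vec.lookup v))
  check? o = exhaust-Vec exhaust-Bool 5 λ v → let col = Vec.lookup v in
    (Fin.any? λ i → Fin.any? λ j → Fin.any? λ k → (col i Bool.≟ true) ×-dec (col j Bool.≟ true) ×-dec (col k Bool.≟ false)
       ×-dec ¬? (forbiddenAdj o i k Bool.≟ forbiddenAdj o j k))
    ⊎-dec (Fin.all? λ i → Fin.all? λ j → (col i Bool.≟ true) →-dec (col j Bool.≟ true) →-dec (i Fin.≟ j))
    ⊎-dec (Fin.all? λ i → col i Bool.≟ true)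

substitution-Free : ∀ G₀ x H → Free G₀ → Free H → ∀ o → ¬ Embeds (substAdj G₀ x H) o
substitution-Free G₀ x H free₀ freeH o (f , f-adj) = cases (obstruction-prime o (tabulate (inside ∘ f)))
  where
  inside : SubstV G₀ x H → Bool
  inside (inj₁ _) = false
  inside (inj₂ _) = true

  at : ∀ {i b} → Vec.lookup (tabulate (inside ∘ f)) i ≡ b → inside (f i) ≡ b
  at {i} p = trans (sym (lookup∘tabulate (inside ∘ f) i)) p

  at⁻ : ∀ {i b} → inside (f i) ≡ b → Vec.lookup (tabulate (inside ∘ f)) i ≡ b
  at⁻ {i} p = trans (lookup∘tabulate (inside ∘ f) i) p

  contract : SubstV G₀ x H → V G₀
  contract (inj₁ (u , _)) = u
  contract (inj₂ _) = x

  contract-adj : ∀ u v → (inside u ≡ true → inside v ≡ true → u ≡ v) →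
    adj G₀ (contract u) (contract v) ≡ substAdj G₀ x H u v
  contract-adj (inj₁ _) (inj₁ _) _ = refl
  contract-adj (inj₁ _) (inj₂ _) _ = refl
  contract-adj (inj₂ _) (inj₁ _) _ = refl
  contract-adj (inj₂ a) (inj₂ b) e with e refl refl
  ... | refl = trans (adj-irrefl G₀ x) (sym (adj-irrefl H a))

  H-vertex : ∀ u → inside u ≡ true → V H
  H-vertex (inj₂ a) _ = a

  H-vertex-adj : ∀ u v p q → adj H (H-vertex u p) (H-vertex v q) ≡ substAdj G₀ x H u v
  H-vertex-adj (inj₂ _) (inj₂ _) _ _ = refl

  same-outside : ∀ u v w → inside u ≡ true → inside v ≡ true → inside w ≡ false → substAdj G₀ x H u w ≡ substAdj G₀ x H v w
  same-outside (inj₂ _) (inj₂ _) (inj₁ _) _ _ _ = refl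

  cases : Separated o (Vec.lookup (tabulate (inside ∘ f))) ⊎ AtMostOne o (Vec.lookup (tabulate (inside ∘ f))) ⊎ AllInside o (Vec.lookup (tabulate (inside ∘ f))) → ⊥
  cases (inj₁ (i , j , k , i∈ , j∈ , k∉ , separated)) = separated
    (trans (sym (f-adj i k)) (trans (same-outside (f i) (f j) (f k) (at i∈) (at j∈) (at k∉)) (f-adj j k)))
  cases (inj₂ (inj₁ one)) = Free⇒¬Embeds G₀ free₀ o ((λ i → contract (f i)) , λ i j →
    trans (contract-adj (f i) (f j) λ p q → cong f (one i j (at⁻ p) (at⁻ q))) (f-adj i j))
  cases (inj₂ (inj₂ all)) = Free⇒¬Embeds H freeH o ((λ i → H-vertex (f i) (at (all i))) , λ i j →
    trans (H-vertex-adj (f i) (f j) _ _) (f-adj i j))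

-- Split unification

required : Part → Part → Maybe Bool
required pA pB = just true
required pB pA = just true
required pA pC = just false
required pC pA = just false
required pA pT = just false
required pT pA = just false
required pC pT = just false
required pT pC = just false
required pL pB = just true
required pB pL = just true
required pL pC = just true
required pC pL = just true
required pL pL = just true
required pT pT = just false
required _ _ = nothing

module _ (o : Obstruction) (col : Fin 5 → Part) where

  Mixes : Set
  Mixes = ∃ λ i → ∃₂ λ j k → col i ≡ pC × col j ≡ pB × col k ≡ pB × j ≢ k ×
    forbiddenAdj o j k ≡ false × forbiddenAdj o i j ≡ true × forbiddenAdj o i k ≡ false

  -- Contracting part p to a single vertex complete to part q changes no adjacency.
  Contractible : Part → Part → Set
  Contractible p q = ∀ i j → col i ≡ p → (col j ≡ p → i ≡ j) × (col j ≡ q → forbiddenAdj o i j ≡ true)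

  Mixes? : Dec Mixes
  Mixes? = Fin.any? λ i → Fin.any? λ j → Fin.any? λ k → (col i ≟P pC) ×-dec (col j ≟P pB) ×-dec (col k ≟P pB) ×-dec
    ¬? (j Fin.≟ k) ×-dec (forbiddenAdj o j k Bool.≟ false) ×-dec (forbiddenAdj o i j Bool.≟ true) ×-dec (forbiddenAdj o i k Bool.≟ false)

  Contractible? : ∀ p q → Dec (Contractible p q)
  Contractible? p q = Fin.all? λ i → Fin.all? λ j → (col i ≟P p) →-dec
    (((col j ≟P p) →-dec (i Fin.≟ j)) ×-dec ((col j ≟P q) →-dec (forbiddenAdj o i j Bool.≟ true)))

Resolved : Obstruction → (Fin 5 → Part) → Set
Resolved o col = Violates o col required ⊎ Mixes o col ⊎ Contractible o col pC pB ⊎ Contractible o col pA pL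

-- Contracting `C` to `c*` can alter only adjacencies within `C` and from `C` to `B`; contracting
-- `A` to `a*`, only those within `A` and from `A` to `L`. The other adjacencies at `C` and `A` are
-- prescribed by `required`. Hence these four cases, checked on all 5^5 colourings of each
-- obstruction.
resolved : ∀ o (v : Vec Part 5) → Resolved o (Vec.lookup v)
resolved = λ { path → from-yes (check? path) ; co-path → from-yes (check? co-path) ; cycle → from-yes (check? cycle) }
  where
  check? : ∀ o → Dec (∀ v → Resolved o (Vec.lookup v))
  check? o = exhaust-Vec exhaust-Part 5 λ v → let col = Vec.lookup v in
    Violates? o col required ⊎-dec Mixes? o col ⊎-dec Contractible? o col pC pB ⊎-dec Contractible? o col pA pL

module _ {A B C L T G₁ G₂ e₁ e₂} (pair : Composable A B C L T G₁ G₂ e₁ e₂) where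
  open Composable pair

  unif : Vᵤ A B C L T → Vᵤ A B C L T → Bool
  unif = unifAdj r₁ r₂

  side : Vᵤ A B C L T → Part
  side (aᵤ _) = pA
  side (bᵤ _) = pB
  side (cᵤ _) = pC
  side (lᵤ _) = pL
  side (tᵤ _) = pT

  r₁-sym : ∀ {x y b} → r₁ x y ≡ b → r₁ y x ≡ b
  r₁-sym p = trans (adj-sym G₁ _ _) p

  r₂-sym : ∀ {x y b} → r₂ x y ≡ b → r₂ y x ≡ b
  r₂-sym p = trans (adj-sym G₂ _ _) p

  required-unif : ∀ x y {b} → x ≢ y → required (side x) (side y) ≡ just b → unif x y ≡ b
  required-unif (aᵤ x) (bᵤ y) _ refl = A-B-complete x y
  required-unif (bᵤ x) (aᵤ y) _ refl = r₁-sym (A-B-complete y x)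
  required-unif (aᵤ x) (cᵤ y) _ refl = refl
  required-unif (cᵤ x) (aᵤ y) _ refl = refl
  required-unif (aᵤ x) (tᵤ y) _ refl = A-T-anticomplete x y
  required-unif (tᵤ x) (aᵤ y) _ refl = r₁-sym (A-T-anticomplete y x)
  required-unif (cᵤ x) (tᵤ y) _ refl = r₂-sym (T-C-anticomplete y x)
  required-unif (tᵤ x) (cᵤ y) _ refl = T-C-anticomplete x y
  required-unif (lᵤ x) (bᵤ y) _ refl = trans (sym (same-on-BLT (l₀ x) (b₀ y))) (L-B-complete x y)
  required-unif (bᵤ x) (lᵤ y) _ refl = trans (sym (same-on-BLT (b₀ x) (l₀ y))) (r₂-sym (L-B-complete y x))
  required-unif (lᵤ x) (cᵤ y) _ refl = L-C-complete x y
  required-unif (cᵤ x) (lᵤ y) _ refl = r₂-sym (L-C-complete y x)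
  required-unif (lᵤ x) (lᵤ y) x≢y refl = L-clique₁ x y λ e → x≢y (cong lᵤ e)
  required-unif (tᵤ x) (tᵤ y) _ refl = T-stable₁ x y

  unmixed-unif : ∀ x y z → side x ≡ pC → side y ≡ pB → side z ≡ pB → y ≢ z →
    unif y z ≡ false → unif x y ≡ true → unif x z ≡ false → ⊥
  unmixed-unif (cᵤ x) (bᵤ y) (bᵤ z) _ _ _ y≢z yz xy xz =
    case trans (sym xy) (trans (C-not-mixed x y z (step (λ e → y≢z (cong bᵤ e)) (trans (same-on-BLT (b₀ y) (b₀ z)) yz) (here z))) xz) of λ ()

  contract-C : Vᵤ A B C L T → V₁ A B L T
  contract-C (aᵤ x) = a₁ x
  contract-C (bᵤ x) = b₁ x
  contract-C (cᵤ x) = c*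
  contract-C (lᵤ x) = l₁ x
  contract-C (tᵤ x) = t₁ x

  contract-A : Vᵤ A B C L T → V₂ B C L T
  contract-A (aᵤ x) = a*
  contract-A (bᵤ x) = b₂ x
  contract-A (cᵤ x) = c₂ x
  contract-A (lᵤ x) = l₂ x
  contract-A (tᵤ x) = t₂ x

  Collapses : Part → Part → Vᵤ A B C L T → Vᵤ A B C L T → Set
  Collapses p q x y = side x ≡ p → (side y ≡ p → x ≡ y) × (side y ≡ q → unif x y ≡ true)

  contract-C-adj : ∀ x y → Collapses pC pB x y → Collapses pC pB y x → r₁ (contract-C x) (contract-C y) ≡ unif x y
  contract-C-adj (aᵤ _) (aᵤ _) _ _ = refl
  contract-C-adj (aᵤ _) (bᵤ _) _ _ = refl
  contract-C-adj (aᵤ x) (cᵤ _) _ _ = r₁-sym (c*-A-anticomplete x)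
  contract-C-adj (aᵤ _) (lᵤ _) _ _ = refl
  contract-C-adj (aᵤ _) (tᵤ _) _ _ = refl
  contract-C-adj (bᵤ _) (aᵤ _) _ _ = refl
  contract-C-adj (bᵤ _) (bᵤ _) _ _ = refl
  contract-C-adj (bᵤ x) (cᵤ _) _ q = trans (r₁-sym (c*-B-complete x)) (sym (r₂-sym (proj₂ (q refl) refl)))
  contract-C-adj (bᵤ _) (lᵤ _) _ _ = refl
  contract-C-adj (bᵤ _) (tᵤ _) _ _ = refl
  contract-C-adj (cᵤ _) (aᵤ y) _ _ = c*-A-anticomplete y
  contract-C-adj (cᵤ _) (bᵤ y) p _ = trans (c*-B-complete y) (sym (proj₂ (p refl) refl))
  contract-C-adj (cᵤ _) (cᵤ _) p _ with proj₁ (p refl) refl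
  ... | refl = trans (adj-irrefl G₁ _) (sym (adj-irrefl G₂ _))
  contract-C-adj (cᵤ x) (lᵤ y) _ _ = trans (c*-L-complete y) (sym (r₂-sym (L-C-complete y x)))
  contract-C-adj (cᵤ x) (tᵤ y) _ _ = trans (c*-T-anticomplete y) (sym (r₂-sym (T-C-anticomplete y x)))
  contract-C-adj (lᵤ _) (aᵤ _) _ _ = refl
  contract-C-adj (lᵤ _) (bᵤ _) _ _ = refl
  contract-C-adj (lᵤ x) (cᵤ y) _ _ = trans (r₁-sym (c*-L-complete x)) (sym (L-C-complete x y))
  contract-C-adj (lᵤ _) (lᵤ _) _ _ = refl
  contract-C-adj (lᵤ _) (tᵤ _) _ _ = refl
  contract-C-adj (tᵤ _) (aᵤ _) _ _ = refl
  contract-C-adj (tᵤ _) (bᵤ _) _ _ = refl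
  contract-C-adj (tᵤ x) (cᵤ y) _ _ = trans (r₁-sym (c*-T-anticomplete x)) (sym (T-C-anticomplete x y))
  contract-C-adj (tᵤ _) (lᵤ _) _ _ = refl
  contract-C-adj (tᵤ _) (tᵤ _) _ _ = refl

  contract-A-adj : ∀ x y → Collapses pA pL x y → Collapses pA pL y x → r₂ (contract-A x) (contract-A y) ≡ unif x y
  contract-A-adj (aᵤ _) (aᵤ _) p _ with proj₁ (p refl) refl
  ... | refl = trans (adj-irrefl G₂ _) (sym (adj-irrefl G₁ _))
  contract-A-adj (aᵤ x) (bᵤ y) _ _ = trans (a*-B-complete y) (sym (A-B-complete x y))
  contract-A-adj (aᵤ _) (cᵤ y) _ _ = a*-C-anticomplete y
  contract-A-adj (aᵤ _) (lᵤ y) p _ = trans (a*-L-complete y) (sym (proj₂ (p refl) refl))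
  contract-A-adj (aᵤ x) (tᵤ y) _ _ = trans (a*-T-anticomplete y) (sym (A-T-anticomplete x y))
  contract-A-adj (bᵤ x) (aᵤ y) _ _ = trans (r₂-sym (a*-B-complete x)) (sym (r₁-sym (A-B-complete y x)))
  contract-A-adj (bᵤ x) (bᵤ y) _ _ = same-on-BLT (b₀ x) (b₀ y)
  contract-A-adj (bᵤ _) (cᵤ _) _ _ = refl
  contract-A-adj (bᵤ x) (lᵤ y) _ _ = same-on-BLT (b₀ x) (l₀ y)
  contract-A-adj (bᵤ x) (tᵤ y) _ _ = same-on-BLT (b₀ x) (t₀ y)
  contract-A-adj (cᵤ x) (aᵤ _) _ _ = r₂-sym (a*-C-anticomplete x)
  contract-A-adj (cᵤ _) (bᵤ _) _ _ = refl
  contract-A-adj (cᵤ _) (cᵤ _) _ _ = refl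
  contract-A-adj (cᵤ _) (lᵤ _) _ _ = refl
  contract-A-adj (cᵤ _) (tᵤ _) _ _ = refl
  contract-A-adj (lᵤ x) (aᵤ _) _ q = trans (r₂-sym (a*-L-complete x)) (sym (r₁-sym (proj₂ (q refl) refl)))
  contract-A-adj (lᵤ x) (bᵤ y) _ _ = same-on-BLT (l₀ x) (b₀ y)
  contract-A-adj (lᵤ _) (cᵤ _) _ _ = refl
  contract-A-adj (lᵤ x) (lᵤ y) _ _ = same-on-BLT (l₀ x) (l₀ y)
  contract-A-adj (lᵤ x) (tᵤ y) _ _ = same-on-BLT (l₀ x) (t₀ y)
  contract-A-adj (tᵤ x) (aᵤ y) _ _ = trans (r₂-sym (a*-T-anticomplete x)) (sym (r₁-sym (A-T-anticomplete y x)))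
  contract-A-adj (tᵤ x) (bᵤ y) _ _ = same-on-BLT (t₀ x) (b₀ y)
  contract-A-adj (tᵤ _) (cᵤ _) _ _ = refl
  contract-A-adj (tᵤ x) (lᵤ y) _ _ = same-on-BLT (t₀ x) (l₀ y)
  contract-A-adj (tᵤ x) (tᵤ y) _ _ = same-on-BLT (t₀ x) (t₀ y)

  unification-Free : Free G₁ → Free G₂ → ∀ o → ¬ Embeds unif o
  unification-Free free₁ free₂ o emb@(f , f-adj) = refute (resolved o colours)
    where
    colours : Vec Part 5
    colours = tabulate (λ i → side (f i))

    col : Fin 5 → Part
    col = Vec.lookup colours

    col-side : ∀ i → col i ≡ side (f i)
    col-side = lookup∘tabulate (λ i → side (f i))

    at : ∀ {i p} → col i ≡ p → side (f i) ≡ p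
    at {i} e = trans (sym (col-side i)) e

    f-≢ : ∀ {i j} → i ≢ j → f i ≢ f j
    f-≢ i≢j e = i≢j (Embeds-injective {r = unif} o emb e)

    collapses : ∀ {p q} → Contractible o col p q → ∀ i j → Collapses p q (f i) (f j)
    collapses contractible i j e with contractible i j (trans (col-side i) e)
    ... | single , joined = (λ e′ → cong f (single (trans (col-side j) e′)))
                          , (λ e′ → trans (f-adj i j) (joined (trans (col-side j) e′)))

    refute : ¬ Resolved o col
    refute (inj₁ (i , j , i≢j , req)) = not-self (trans (sym (f-adj i j))
      (required-unif (f i) (f j) (f-≢ i≢j) (trans (sym (cong₂ required (col-side i) (col-side j))) req)))
    refute (inj₂ (inj₁ (i , j , k , i∈C , j∈B , k∈B , j≢k , jk , ij , ik))) =
      unmixed-unif (f i) (f j) (f k) (at i∈C) (at j∈B) (at k∈B) (f-≢ j≢k)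
        (trans (f-adj j k) jk) (trans (f-adj i j) ij) (trans (f-adj i k) ik)
    refute (inj₂ (inj₂ (inj₁ contractible))) = Free⇒¬Embeds G₁ free₁ o
      ( (λ i → Inverse.from e₁ (contract-C (f i)))
      , λ i j → trans (contract-C-adj (f i) (f j) (collapses contractible i j) (collapses contractible j i)) (f-adj i j))
    refute (inj₂ (inj₂ (inj₂ contractible))) = Free⇒¬Embeds G₂ free₂ o
      ( (λ i → Inverse.from e₂ (contract-A (f i)))
      , λ i j → trans (contract-A-adj (f i) (f j) (collapses contractible i j) (collapses contractible j i)) (f-adj i j))

-- Transfer along isomorphism and complementation

IsoTo-Free : ∀ G {W} r → IsoTo G W r → (∀ o → ¬ Embeds r o) → Free G
IsoTo-Free G r (e , e-adj) none = ¬Embeds⇒Free G λ o emb →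
  none o (Embeds-map {r = adj G} {r′ = r} {o = o} (Inverse.to e) e-adj emb)

substitution⇒Free : ∀ G → ObtainedBySubstitution G → Free G
substitution⇒Free G (G₀ , x , H , _ , _ , free₀ , freeH , iso) =
  IsoTo-Free G (substAdj G₀ x H) iso (substitution-Free G₀ x H free₀ freeH)

unification⇒Free : ∀ G → ObtainedBySplitUnification G → Free G
unification⇒Free G (_ , _ , _ , _ , _ , _ , _ , _ , _ , pair , free₁ , free₂ , _ , _ , iso) =
  IsoTo-Free G (unif pair) iso (unification-Free pair free₁ free₂)

Divide-compl : ∀ G → Divide (NonAdjacent G) (Adjacent G) → Divide (Adjacent (compl G)) (NonAdjacent (compl G))
Divide-compl G D = record
  { part = part
  ; A-B = λ x y → compl-Adjacent G (A-B x y)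
  ; A-T = λ x y → compl-NonAdjacent G (A-T x y)
  ; A-C = λ x y → compl-NonAdjacent G (A-C x y)
  ; C-T = λ x y → compl-NonAdjacent G (C-T x y)
  ; L-B = λ x y → compl-Adjacent G (L-B x y)
  ; L-C = λ x y → compl-Adjacent G (L-C x y)
  ; L-L = λ x y x≢y → compl-Adjacent G (L-L x y x≢y)
  ; T-T = λ x y x≢y → compl-NonAdjacent G (T-T x y x≢y)
  ; a = a ; a∈A = a∈A ; a-L = λ l → compl-Adjacent G (a-L l)
  ; a′ = a′ ; a′∈A = a′∈A ; a′≢a = a′≢a
  ; c = c ; c∈C = c∈C ; c-B = λ b → compl-Adjacent G (c-B b)
  ; c′ = c′ ; c′∈C = c′∈C ; c′≢c = c′≢c
  ; C-unmixed = λ x b b′ b≁b′ x~b → compl-Adjacent G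
      (C-unmixed x b b′ (compl-NonAdjacent⁻ G b≁b′) (compl-Adjacent⁻ G x~b))
  }
  where open Divide D

-- An obstruction of `compl G` first reappears in the double complement, whose adjacency agrees with
-- that of `G` only pointwise; `double` carries it back.
Free-compl : ∀ G → Free G → Free (compl G)
Free-compl G free = ¬Embeds⇒Free (compl G) λ o e → Free⇒¬Embeds G free (co-obstruction o)
  (Embeds-map {r = complAdj (compl G)} {r′ = adj G} {o = co-obstruction o} (λ x → x) double (Embeds-compl (compl G) {o} e))
  where
  double : ∀ x y → adj G x y ≡ complAdj (compl G) x y
  double x y with trichotomy G x y
  ... | inj₁ refl = trans (adj-irrefl G x) (sym (complAdj-irrefl (compl G) x))
  ... | inj₂ (inj₁ p) = trans p (sym (compl-Adjacent (compl G) (compl-NonAdjacent G p)))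
  ... | inj₂ (inj₂ q@(_ , e)) = trans e (sym (proj₂ (compl-NonAdjacent (compl G) (compl-Adjacent G q))))

theorem5p3 : (G : Graph) →
    Free G ⇔ (IsSplit G ⊎ ObtainedBySubstitution G ⊎
    (ObtainedBySplitUnification G ⊎ ObtainedBySplitUnification (compl G)))
theorem5p3 G = mk⇔ decompose compose
  where
  decompose : Free G → _
  decompose free with split-or-divide (structure G free)
  ... | inj₁ (K , clique , stable) = inj₁ (K , (λ x y → clique) , stable′)
    where
    stable′ : ∀ x y → K x ≡ false → K y ≡ false → adj G x y ≡ false
    stable′ x y p q with _≟V_ G x y
    ... | yes refl = adj-irrefl G x
    ... | no x≢y = proj₂ (stable x≢y p q)
  ... | inj₂ (inj₁ D) = inj₂ (inj₂ (inj₁ (FromDivide.obtained G free D)))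
  ... | inj₂ (inj₂ D) = inj₂ (inj₂ (inj₂ (FromDivide.obtained (compl G) (Free-compl G free) (Divide-compl G D))))
  compose : _ → Free G
  compose (inj₁ split) = IsSplit⇒Free G split
  compose (inj₂ (inj₁ substitution)) = substitution⇒Free G substitution
  compose (inj₂ (inj₂ (inj₁ unification))) = unification⇒Free G unification
  compose (inj₂ (inj₂ (inj₂ unification))) = Free-compl⁻ G (unification⇒Free (compl G) unification)
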